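{- For every monotonic (non-decreasing or non-increasing) sequence of speeds $(s_i)_{i\ge2}$ with $s_i\ge1$, the algorithm $\mathcal{S}$-DC is not competitive for the infinite server problem on the half-line $[0,\infty)$ with source $0$.
   Context: Infinite server problem on the half-line $[0,\infty)$ with source $0$: an unbounded number of servers initially reside at $0$; requests are revealed one by one and must be served immediately, without knowledge of future requests, by moving a server to the request; the cost is the total distance traveled. With $\mathcal{S}=\{s_i : i\ge2\}$, denote by $x_i$ the $i$-th server from the right. Algorithm $\mathcal{S}$-DC: if a request lies between servers $x_{i+1}$ (to its left) and $x_i$ (to its right), move them towards it with speeds $s_{i+1}$ and $1$ respectively until one of them reaches it; if no server is to the right of the request, move the rightmost server to the request. An online algorithm is competitive if there are $\rho,c$ with $ALG(\sigma)\le\rho\,OPT(\sigma)+c$ for all request sequences $\sigma$. -}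

module Defs where

open import Data.List.Base using (List; []; _∷_)
open import Data.Nat.Base as ℕ using (ℕ; zero; suc)
import Data.Nat.Properties as ℕ
open import Data.Product.Base using (∃-syntax; _×_; _,_)
open import Data.Rational.Base as ℚ using (ℚ; 0ℚ; 1ℚ; ½; Positive; NonNegative)
import Data.Rational.Properties as ℚ
open import Data.Sum.Base using (_⊎_; inj₁; inj₂)
open import Level using (0ℓ)
open import Relation.Binary.PropositionalEquality using (_≡_; _≢_; refl; sym; trans; cong; cong₂; subst)
open import Relation.Nullary.Decidable.Core using (dec⇒maybe)
open import Tactic.RingSolver using (solve-∀)
open import Tactic.RingSolver.Core.AlmostCommutativeRing using (AlmostCommutativeRing; fromCommutativeRing)

------------------------------------------------------------------------
-- Rational estimates

module Estimates where
  open ℚ.≤-Reasoning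

  ℚ-ring : AlmostCommutativeRing 0ℓ 0ℓ
  ℚ-ring = fromCommutativeRing ℚ.+-*-commutativeRing (λ p → dec⇒maybe (0ℚ ℚ.≟ p))

  halves : ∀ ε → ½ ℚ.* ε ℚ.+ ½ ℚ.* ε ≡ ε
  halves = solve-∀ ℚ-ring

  neg-sub : ∀ p q → ℚ.- (p ℚ.+ ℚ.- q) ≡ q ℚ.+ ℚ.- p
  neg-sub = solve-∀ ℚ-ring

  sub-neg : ∀ p q → ℚ.- p ℚ.+ ℚ.- (ℚ.- q) ≡ q ℚ.+ ℚ.- p
  sub-neg = solve-∀ ℚ-ring

  add-sub : ∀ p q → p ≡ q ℚ.+ (p ℚ.+ ℚ.- q)
  add-sub = solve-∀ ℚ-ring

  add-sub′ : ∀ p q → (p ℚ.+ q) ℚ.+ ℚ.- p ≡ q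
  add-sub′ = solve-∀ ℚ-ring

  sub-+ : ∀ p q r s → (p ℚ.+ r) ℚ.+ ℚ.- (q ℚ.+ s) ≡ (p ℚ.+ ℚ.- q) ℚ.+ (r ℚ.+ ℚ.- s)
  sub-+ = solve-∀ ℚ-ring

  sub-* : ∀ p q r s →
    p ℚ.* r ℚ.+ ℚ.- (q ℚ.* s) ≡ p ℚ.* (r ℚ.+ ℚ.- s) ℚ.+ s ℚ.* (p ℚ.+ ℚ.- q)
  sub-* = solve-∀ ℚ-ring

  ∣p-q∣≡∣q-p∣ : ∀ p q → ℚ.∣ p ℚ.- q ∣ ≡ ℚ.∣ q ℚ.- p ∣
  ∣p-q∣≡∣q-p∣ p q = trans (sym (ℚ.∣-p∣≡∣p∣ (p ℚ.- q)))
    (cong ℚ.∣_∣ (neg-sub p q))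

  ∣p∣≤∣q∣+∣p-q∣ : ∀ p q → ℚ.∣ p ∣ ℚ.≤ ℚ.∣ q ∣ ℚ.+ ℚ.∣ p ℚ.- q ∣
  ∣p∣≤∣q∣+∣p-q∣ p q = begin
    ℚ.∣ p ∣                    ≡⟨ cong ℚ.∣_∣ (add-sub p q) ⟩
    ℚ.∣ q ℚ.+ (p ℚ.- q) ∣      ≤⟨ ℚ.∣p+q∣≤∣p∣+∣q∣ q (p ℚ.- q) ⟩
    ℚ.∣ q ∣ ℚ.+ ℚ.∣ p ℚ.- q ∣  ∎

  ∣p∣-∣q∣≤∣p-q∣ : ∀ p q → ℚ.∣ p ∣ ℚ.- ℚ.∣ q ∣ ℚ.≤ ℚ.∣ p ℚ.- q ∣
  ∣p∣-∣q∣≤∣p-q∣ p q = begin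
    ℚ.∣ p ∣ ℚ.- ℚ.∣ q ∣
      ≤⟨ ℚ.+-monoˡ-≤ (ℚ.- ℚ.∣ q ∣) (∣p∣≤∣q∣+∣p-q∣ p q) ⟩
    ℚ.∣ q ∣ ℚ.+ ℚ.∣ p ℚ.- q ∣ ℚ.- ℚ.∣ q ∣
      ≡⟨ add-sub′ ℚ.∣ q ∣ ℚ.∣ p ℚ.- q ∣ ⟩
    ℚ.∣ p ℚ.- q ∣
      ∎

  ∣∣p∣-∣q∣∣≤∣p-q∣ : ∀ p q → ℚ.∣ ℚ.∣ p ∣ ℚ.- ℚ.∣ q ∣ ∣ ℚ.≤ ℚ.∣ p ℚ.- q ∣
  ∣∣p∣-∣q∣∣≤∣p-q∣ p q with ℚ.∣p∣≡p∨∣p∣≡-p (ℚ.∣ p ∣ ℚ.- ℚ.∣ q ∣)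
  ... | inj₁ eq = subst (ℚ._≤ ℚ.∣ p ℚ.- q ∣) (sym eq) (∣p∣-∣q∣≤∣p-q∣ p q)
  ... | inj₂ eq = begin
    ℚ.∣ ℚ.∣ p ∣ ℚ.- ℚ.∣ q ∣ ∣  ≡⟨ eq ⟩
    ℚ.- (ℚ.∣ p ∣ ℚ.- ℚ.∣ q ∣)  ≡⟨ neg-sub ℚ.∣ p ∣ ℚ.∣ q ∣ ⟩
    ℚ.∣ q ∣ ℚ.- ℚ.∣ p ∣        ≤⟨ ∣p∣-∣q∣≤∣p-q∣ q p ⟩
    ℚ.∣ q ℚ.- p ∣              ≡⟨ ∣p-q∣≡∣q-p∣ q p ⟩
    ℚ.∣ p ℚ.- q ∣              ∎

  ∣[p+r]-[q+s]∣≤ : ∀ p q r s →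
    ℚ.∣ (p ℚ.+ r) ℚ.- (q ℚ.+ s) ∣ ℚ.≤ ℚ.∣ p ℚ.- q ∣ ℚ.+ ℚ.∣ r ℚ.- s ∣
  ∣[p+r]-[q+s]∣≤ p q r s = begin
    ℚ.∣ (p ℚ.+ r) ℚ.- (q ℚ.+ s) ∣
      ≡⟨ cong ℚ.∣_∣ (sub-+ p q r s) ⟩
    ℚ.∣ (p ℚ.- q) ℚ.+ (r ℚ.- s) ∣
      ≤⟨ ℚ.∣p+q∣≤∣p∣+∣q∣ (p ℚ.- q) (r ℚ.- s) ⟩
    ℚ.∣ p ℚ.- q ∣ ℚ.+ ℚ.∣ r ℚ.- s ∣
      ∎

  ∣-p--q∣≡∣p-q∣ : ∀ p q → ℚ.∣ (ℚ.- p) ℚ.- (ℚ.- q) ∣ ≡ ℚ.∣ p ℚ.- q ∣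
  ∣-p--q∣≡∣p-q∣ p q = trans
    (cong ℚ.∣_∣ (sub-neg p q))
    (∣p-q∣≡∣q-p∣ q p)

  ∣pr-qs∣≤ : ∀ p q r s →
    ℚ.∣ p ℚ.* r ℚ.- q ℚ.* s ∣ ℚ.≤ ℚ.∣ p ∣ ℚ.* ℚ.∣ r ℚ.- s ∣ ℚ.+ ℚ.∣ s ∣ ℚ.* ℚ.∣ p ℚ.- q ∣
  ∣pr-qs∣≤ p q r s = begin
    ℚ.∣ p ℚ.* r ℚ.- q ℚ.* s ∣
      ≡⟨ cong ℚ.∣_∣ (sub-* p q r s) ⟩
    ℚ.∣ p ℚ.* (r ℚ.- s) ℚ.+ s ℚ.* (p ℚ.- q) ∣
      ≤⟨ ℚ.∣p+q∣≤∣p∣+∣q∣ (p ℚ.* (r ℚ.- s)) (s ℚ.* (p ℚ.- q)) ⟩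
    ℚ.∣ p ℚ.* (r ℚ.- s) ∣ ℚ.+ ℚ.∣ s ℚ.* (p ℚ.- q) ∣
      ≡⟨ cong₂ ℚ._+_ (ℚ.∣p*q∣≡∣p∣*∣q∣ p (r ℚ.- s)) (ℚ.∣p*q∣≡∣p∣*∣q∣ s (p ℚ.- q)) ⟩
    ℚ.∣ p ∣ ℚ.* ℚ.∣ r ℚ.- s ∣ ℚ.+ ℚ.∣ s ∣ ℚ.* ℚ.∣ p ℚ.- q ∣
      ∎

  *-mono-≤ : ∀ {p q r s} → .{{NonNegative r}} → .{{NonNegative q}} →
    p ℚ.≤ q → r ℚ.≤ s → p ℚ.* r ℚ.≤ q ℚ.* s
  *-mono-≤ {p} {q} {r} {s} p≤q r≤s =
    ℚ.≤-trans (ℚ.*-monoʳ-≤-nonNeg r p≤q) (ℚ.*-monoˡ-≤-nonNeg q r≤s)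

  product-close : ∀ B C δ p q r s → NonNegative B → NonNegative C →
    ℚ.∣ p ∣ ℚ.≤ B → ℚ.∣ s ∣ ℚ.≤ C → ℚ.∣ p ℚ.- q ∣ ℚ.≤ δ → ℚ.∣ r ℚ.- s ∣ ℚ.≤ δ →
    ℚ.∣ p ℚ.* r ℚ.- q ℚ.* s ∣ ℚ.≤ (B ℚ.+ C) ℚ.* δ
  product-close B C δ p q r s B≥0 C≥0 p≤B s≤C pq≤δ rs≤δ = begin
    ℚ.∣ p ℚ.* r ℚ.- q ℚ.* s ∣
      ≤⟨ ∣pr-qs∣≤ p q r s ⟩
    ℚ.∣ p ∣ ℚ.* ℚ.∣ r ℚ.- s ∣ ℚ.+ ℚ.∣ s ∣ ℚ.* ℚ.∣ p ℚ.- q ∣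
      ≤⟨ ℚ.+-mono-≤ (*-mono-≤ {{ℚ.∣-∣-nonNeg (r ℚ.- s)}} {{B≥0}} p≤B rs≤δ)
                    (*-mono-≤ {{ℚ.∣-∣-nonNeg (p ℚ.- q)}} {{C≥0}} s≤C pq≤δ) ⟩
    B ℚ.* δ ℚ.+ C ℚ.* δ
      ≡⟨ ℚ.*-distribʳ-+ δ B C ⟨
    (B ℚ.+ C) ℚ.* δ
      ∎

  scale : ∀ B → .{{Positive B}} → ∀ ε → .{{Positive ε}} → ∃[ δ ] (Positive δ × B ℚ.* δ ≡ ε)
  scale B ε = B⁻¹ ℚ.* ε , ℚ.pos*pos⇒pos B⁻¹ {{ℚ.1/pos⇒pos B}} ε , (begin-equality
    B ℚ.* (B⁻¹ ℚ.* ε)  ≡⟨ ℚ.*-assoc B B⁻¹ ε ⟨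
    B ℚ.* B⁻¹ ℚ.* ε    ≡⟨ cong (ℚ._* ε) (ℚ.*-inverseʳ B {{ℚ.pos⇒nonZero B}}) ⟩
    1ℚ ℚ.* ε           ≡⟨ ℚ.*-identityˡ ε ⟩
    ε                  ∎)
    where
    B⁻¹ : ℚ
    B⁻¹ = (ℚ.1/ B) {{ℚ.pos⇒nonZero B}}

  p≤p+ε : ∀ p ε → .{{Positive ε}} → p ℚ.≤ p ℚ.+ ε
  p≤p+ε p ε = begin
    p           ≡⟨ ℚ.+-identityʳ p ⟨
    p ℚ.+ 0ℚ    ≤⟨ ℚ.+-monoʳ-≤ p (ℚ.<⇒≤ (ℚ.positive⁻¹ ε)) ⟩
    p ℚ.+ ε     ∎

open Estimates

------------------------------------------------------------------------
-- Real numbers as Cauchy sequences of rationals, with equality _≈_.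
-- The order is not decidable, so algorithms on reals are given below as
-- relations; these determine positions and costs up to _≈_.

IsCauchy : (ℕ → ℚ) → Set
IsCauchy u = ∀ ε → .{{Positive ε}} →
  ∃[ N ] (∀ m n → N ℕ.≤ m → N ℕ.≤ n → ℚ.∣ u m ℚ.- u n ∣ ℚ.≤ ε)

record ℝ : Set where
  constructor mkℝ
  field
    seq    : ℕ → ℚ
    cauchy : IsCauchy seq

open ℝ public

infix 4 _≤_ _≈_

_≤_ : ℝ → ℝ → Set
x ≤ y = ∀ ε → .{{Positive ε}} →
  ∃[ N ] (∀ n → N ℕ.≤ n → seq x n ℚ.≤ seq y n ℚ.+ ε)

_≈_ : ℝ → ℝ → Set
x ≈ y = x ≤ y × y ≤ x

≤-refl : ∀ x → x ≤ x
≤-refl x ε = 0 , λ n _ → p≤p+ε (seq x n) ε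

Bounded : (ℕ → ℚ) → ℚ → ℕ → Set
Bounded u B M = ∀ n → M ℕ.≤ n → ℚ.∣ u n ∣ ℚ.≤ B

Close : (ℕ → ℚ) → ℚ → ℕ → Set
Close u ε N = ∀ m n → N ℕ.≤ m → N ℕ.≤ n → ℚ.∣ u m ℚ.- u n ∣ ℚ.≤ ε

abstract
  const-cauchy : ∀ q → IsCauchy (λ _ → q)
  const-cauchy q ε = 0 , λ _ _ _ _ → subst (ℚ._≤ ε) (sym ∣q-q∣≡0) (ℚ.<⇒≤ (ℚ.positive⁻¹ ε))
    where
    ∣q-q∣≡0 : ℚ.∣ q ℚ.- q ∣ ≡ 0ℚ
    ∣q-q∣≡0 = cong ℚ.∣_∣ (ℚ.+-inverseʳ q)

  neg-cauchy : ∀ {u} → IsCauchy u → IsCauchy (λ n → ℚ.- u n)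
  neg-cauchy {u} cu ε with N , p ← cu ε = N , λ m n N≤m N≤n →
    subst (ℚ._≤ ε) (sym (∣-p--q∣≡∣p-q∣ (u m) (u n))) (p m n N≤m N≤n)

  abs-cauchy : ∀ {u} → IsCauchy u → IsCauchy (λ n → ℚ.∣ u n ∣)
  abs-cauchy {u} cu ε with N , p ← cu ε = N , λ m n N≤m N≤n →
    ℚ.≤-trans (∣∣p∣-∣q∣∣≤∣p-q∣ (u m) (u n)) (p m n N≤m N≤n)

  +-cauchy : ∀ {u v} → IsCauchy u → IsCauchy v → IsCauchy (λ n → u n ℚ.+ v n)
  +-cauchy {u} {v} cu cv ε
    with M , p ← cu (½ ℚ.* ε) {{ℚ.pos*pos⇒pos ½ ε}}
       | N , q ← cv (½ ℚ.* ε) {{ℚ.pos*pos⇒pos ½ ε}}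
    = M ℕ.⊔ N , λ m n K≤m K≤n → begin
      ℚ.∣ (u m ℚ.+ v m) ℚ.- (u n ℚ.+ v n) ∣
        ≤⟨ ∣[p+r]-[q+s]∣≤ (u m) (u n) (v m) (v n) ⟩
      ℚ.∣ u m ℚ.- u n ∣ ℚ.+ ℚ.∣ v m ℚ.- v n ∣
        ≤⟨ ℚ.+-mono-≤ (p m n (ℕ.m⊔n≤o⇒m≤o M N K≤m) (ℕ.m⊔n≤o⇒m≤o M N K≤n))
                      (q m n (ℕ.m⊔n≤o⇒n≤o M N K≤m) (ℕ.m⊔n≤o⇒n≤o M N K≤n)) ⟩
      ½ ℚ.* ε ℚ.+ ½ ℚ.* ε
        ≡⟨ halves ε ⟩
      ε
        ∎
    where open ℚ.≤-Reasoning

  cauchy-bounded : ∀ {u} → IsCauchy u →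
    ∃[ B ] (Positive B × ∃[ N ] (∀ n → N ℕ.≤ n → ℚ.∣ u n ∣ ℚ.≤ B))
  cauchy-bounded {u} cu with N , p ← cu 1ℚ =
    ℚ.∣ u N ∣ ℚ.+ 1ℚ , positive-bound , N , λ n N≤n →
      ℚ.≤-trans (∣p∣≤∣q∣+∣p-q∣ (u n) (u N))
                (ℚ.+-monoʳ-≤ ℚ.∣ u N ∣ (p n N N≤n ℕ.≤-refl))
    where
    positive-bound : Positive (ℚ.∣ u N ∣ ℚ.+ 1ℚ)
    positive-bound = subst Positive (ℚ.+-comm 1ℚ ℚ.∣ u N ∣)
      (ℚ.pos+nonNeg⇒pos 1ℚ ℚ.∣ u N ∣ {{ℚ.∣-∣-nonNeg (u N)}})

  *-close : ∀ u v B C δ M₁ M₂ N₁ N₂ → Positive B → Positive C →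
    Bounded u B M₁ → Bounded v C M₂ → Close u δ N₁ → Close v δ N₂ →
    Close (λ n → u n ℚ.* v n) ((B ℚ.+ C) ℚ.* δ) ((M₁ ℕ.⊔ M₂) ℕ.⊔ (N₁ ℕ.⊔ N₂))
  *-close u v B C δ M₁ M₂ N₁ N₂ B>0 C>0 u≤B v≤C p q m n K≤m K≤n =
    product-close B C δ (u m) (u n) (v m) (v n)
      (ℚ.pos⇒nonNeg B {{B>0}}) (ℚ.pos⇒nonNeg C {{C>0}})
      (u≤B m (ℕ.m⊔n≤o⇒m≤o M₁ M₂ (M≤ K≤m)))
      (v≤C n (ℕ.m⊔n≤o⇒n≤o M₁ M₂ (M≤ K≤n)))
      (p m n (ℕ.m⊔n≤o⇒m≤o N₁ N₂ (N≤ K≤m)) (ℕ.m⊔n≤o⇒m≤o N₁ N₂ (N≤ K≤n)))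
      (q m n (ℕ.m⊔n≤o⇒n≤o N₁ N₂ (N≤ K≤m)) (ℕ.m⊔n≤o⇒n≤o N₁ N₂ (N≤ K≤n)))
    where
    M≤ : ∀ {n} → (M₁ ℕ.⊔ M₂) ℕ.⊔ (N₁ ℕ.⊔ N₂) ℕ.≤ n → M₁ ℕ.⊔ M₂ ℕ.≤ n
    M≤ = ℕ.m⊔n≤o⇒m≤o (M₁ ℕ.⊔ M₂) (N₁ ℕ.⊔ N₂)
    N≤ : ∀ {n} → (M₁ ℕ.⊔ M₂) ℕ.⊔ (N₁ ℕ.⊔ N₂) ℕ.≤ n → N₁ ℕ.⊔ N₂ ℕ.≤ n
    N≤ = ℕ.m⊔n≤o⇒n≤o (M₁ ℕ.⊔ M₂) (N₁ ℕ.⊔ N₂)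

  *-cauchy : ∀ {u v} → IsCauchy u → IsCauchy v → IsCauchy (λ n → u n ℚ.* v n)
  *-cauchy {u} {v} cu cv ε = bounded (cauchy-bounded cu) (cauchy-bounded cv)
    where
    Goal : Set
    Goal = ∃[ K ] Close (λ n → u n ℚ.* v n) ε K

    close : ∀ B C δ M₁ M₂ → Positive B → Positive C →
      Bounded u B M₁ → Bounded v C M₂ → (B ℚ.+ C) ℚ.* δ ≡ ε →
      ∃[ N ] Close u δ N → ∃[ N ] Close v δ N → Goal
    close B C δ M₁ M₂ B>0 C>0 u≤B v≤C eq (N₁ , p) (N₂ , q) =
      (M₁ ℕ.⊔ M₂) ℕ.⊔ (N₁ ℕ.⊔ N₂) ,
      subst (λ η → Close (λ n → u n ℚ.* v n) η ((M₁ ℕ.⊔ M₂) ℕ.⊔ (N₁ ℕ.⊔ N₂))) eq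
        (*-close u v B C δ M₁ M₂ N₁ N₂ B>0 C>0 u≤B v≤C p q)

    scaled : ∀ B C M₁ M₂ → Positive B → Positive C → Bounded u B M₁ → Bounded v C M₂ →
      ∃[ δ ] (Positive δ × (B ℚ.+ C) ℚ.* δ ≡ ε) → Goal
    scaled B C M₁ M₂ B>0 C>0 u≤B v≤C (δ , δ>0 , eq) =
      close B C δ M₁ M₂ B>0 C>0 u≤B v≤C eq (cu δ {{δ>0}}) (cv δ {{δ>0}})

    bounded : ∃[ B ] (Positive B × ∃[ M ] Bounded u B M) →
              ∃[ C ] (Positive C × ∃[ M ] Bounded v C M) → Goal
    bounded (B , B>0 , M₁ , u≤B) (C , C>0 , M₂ , v≤C) =
      scaled B C M₁ M₂ B>0 C>0 u≤B v≤C
        (scale (B ℚ.+ C) {{ℚ.pos+pos⇒pos B {{B>0}} C {{C>0}}}} ε)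

infix  8 -_
infixl 7 _*_
infixl 6 _+_ _-_

0ℝ 1ℝ : ℝ
0ℝ = mkℝ (λ _ → 0ℚ) (const-cauchy 0ℚ)
1ℝ = mkℝ (λ _ → 1ℚ) (const-cauchy 1ℚ)

-_ ∣_∣ : ℝ → ℝ
- x   = mkℝ (λ n → ℚ.- seq x n) (neg-cauchy {seq x} (cauchy x))
∣ x ∣ = mkℝ (λ n → ℚ.∣ seq x n ∣) (abs-cauchy {seq x} (cauchy x))

_+_ _-_ _*_ : ℝ → ℝ → ℝ
x + y = mkℝ (λ n → seq x n ℚ.+ seq y n) (+-cauchy {seq x} {seq y} (cauchy x) (cauchy y))
x - y = x + (- y)
x * y = mkℝ (λ n → seq x n ℚ.* seq y n) (*-cauchy {seq x} {seq y} (cauchy x) (cauchy y))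

------------------------------------------------------------------------
-- The infinite server problem on [0,∞) with source 0

record Point : Set where
  constructor mkPoint
  field
    pos    : ℝ
    nonNeg : 0ℝ ≤ pos

open Point public

Config : Set
Config = ℕ → Point

source : Config
source _ = mkPoint 0ℝ (≤-refl 0ℝ)

∑< : ℕ → (ℕ → ℝ) → ℝ
∑< zero    f = 0ℝ
∑< (suc n) f = ∑< n f + f n

-- Only finitely many servers move between two consecutive configurations;
-- d is the total distance they travel.
Travel : Config → Config → ℝ → Set
Travel x x′ d = ∃[ N ]
  ( (∀ j → N ℕ.≤ j → pos (x′ j) ≈ pos (x j))
  × d ≈ ∑< N (λ j → ∣ pos (x′ j) - pos (x j) ∣) )

Rule : Set₁
Rule = Config → Point → Config → Set

-- Run step x σ d: starting from x, the requests σ can be served one after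
-- the other by transitions allowed by step, at total cost d.
data Run (step : Rule) : Config → List Point → ℝ → Set where
  done  : ∀ {x c} → c ≈ 0ℝ → Run step x [] c
  serve : ∀ {x x′ r σ d e c} →
          step x r x′ → Travel x x′ d → Run step x′ σ e → c ≈ d + e →
          Run step x (r ∷ σ) c

Serves : Rule
Serves x r x′ = ∃[ j ] pos (x′ j) ≈ pos r

-- OPT(σ) = v, as the infimum of the costs of all offline solutions.
OPT : List Point → ℝ → Set
OPT σ v = (∀ d → Run Serves source σ d → v ≤ d)
        × (∀ w → (∀ d → Run Serves source σ d → w ≤ d) → w ≤ v)

-- An algorithm is given by the graph of its cost function.
Competitive : (List Point → ℝ → Set) → Set
Competitive ALG = ∃[ ρ ] ∃[ c ]
  (∀ σ a v → ALG σ a → OPT σ v → a ≤ ρ * v + c)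

------------------------------------------------------------------------
-- The algorithm 𝒮-DC

-- Indices are shifted to start at 0: x k is the (k+1)-st server from the
-- right, and s k stands for the speed s_{k+2}, so that the left server x (suc i)
-- of the pair x (suc i) ≤ x i moves at speed s i. Servers never overtake one
-- another, hence this order from right to left is preserved by every step.
data DCStep (s : ℕ → ℝ) (x : Config) (r : Point) (x′ : Config) : Set where
  outer : pos (x 0) ≤ pos r →
          pos (x′ 0) ≈ pos r →
          (∀ j → j ≢ 0 → pos (x′ j) ≈ pos (x j)) →
          DCStep s x r x′

  -- t is the first time at which one of the two servers reaches r.
  inner : ∀ i t →
          pos (x (suc i)) ≤ pos r → pos r ≤ pos (x i) →
          0ℝ ≤ t →
          pos (x′ (suc i)) ≈ pos (x (suc i)) + s i * t →
          pos (x′ i) ≈ pos (x i) - t →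
          pos (x′ (suc i)) ≤ pos r → pos r ≤ pos (x′ i) →
          pos (x′ (suc i)) ≈ pos r ⊎ pos (x′ i) ≈ pos r →
          (∀ j → j ≢ i → j ≢ suc i → pos (x′ j) ≈ pos (x j)) →
          DCStep s x r x′

DC : (ℕ → ℝ) → List Point → ℝ → Set
DC s = Run (DCStep s) source

{-# OPTIONS --safe #-}
module Submission where

-- The adversary keeps h offline servers on a cluster of h points spaced by 1, which are also
-- the positions of h servers of the algorithm; server m, next to their left, is still at 0.
-- If an offline server moves left by a small a, then calling the algorithm's server i to the
-- new point and servers i+1, …, m-1 back to their old ones displaces every server in turn:
-- since all speeds are at least 1, this costs at least (m-i)a and pulls server m to the right
-- by a s_i ⋯ s_{m-1}. Moving the whole cluster left by D thus costs h D offline and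
-- τ D + (travel of m) online, where τ = h(h+1)/2. D is chosen such that server m ends at
-- distance 1 from the cluster. It then replaces the cluster's rightmost server, and the game
-- goes on with server m+1. If all clusters are at distance at least τ from the source, then
-- every such phase costs τ(D+1) at least online, but only h(D+1) offline. After τ phases the
-- initial offline cost O(h Q) of a cluster at distance Q is amortised, so the ratio is Ω(h).

open import Defs
open import Data.Bool.Base using (if_then_else_)
open import Data.Empty using (⊥)
import Data.Integer.Base as ℤ
import Data.Integer.Properties as ℤ
open import Data.List.Base using (List; []; _∷_; _++_)
open import Data.Nat.Base as ℕ using (ℕ; zero; suc)
import Data.Nat.Properties as ℕ
open import Data.Product.Base using (∃-syntax; _×_; _,_; proj₁; proj₂)
open import Data.Rational.Base as ℚ using (ℚ; 0ℚ; 1ℚ; ½; mkℚ; Positive)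
import Data.Rational.Properties as ℚ
import Data.Rational.Unnormalised.Base as ℚᵘ
import Data.Rational.Unnormalised.Properties as ℚᵘ
open import Data.Sum.Base using (_⊎_; inj₁; inj₂)
open import Function.Base using (_∘_)
open import Relation.Binary.Definitions using (Monotonic₁; Antitonic₁)
open import Relation.Binary.PropositionalEquality
  using (_≡_; _≢_; refl; sym; trans; cong; cong₂; subst; subst₂)
open import Relation.Nullary.Decidable.Core using (Dec; yes; no; does; _×-dec_)
open import Relation.Nullary.Negation.Core using (¬_; contradiction)
open import Tactic.RingSolver using (solve-∀)

open Estimates using (ℚ-ring)

-- Three obstacles shape the proof. The order of the reals is undecidable, so the adversary never
-- branches on a comparison of reals: speeds and positions are represented such that every
-- inequality used along the play holds at each index of the Cauchy sequences, and cost estimates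
-- become rational arithmetic. `Competitive` constrains only those request sequences for which a
-- value of `OPT` is supplied. An offline solution alone therefore proves nothing: the infimum
-- itself has to be exhibited, as a minimum over finitely many lazy strategies. Finally, the
-- distance D of a phase depends on speeds of servers that are still at the source and on where the
-- phase is to end. The clusters are therefore planned backwards in time, from a last one at τ to a
-- first one beyond 2τ, and the initial deployment has to produce that first cluster exactly.

abstract
  0≤1 : 0ℚ ℚ.≤ 1ℚ
  0≤1 = ℚ.<⇒≤ (ℚ.positive⁻¹ 1ℚ)

  0≤½ : 0ℚ ℚ.≤ ½
  0≤½ = ℚ.<⇒≤ (ℚ.positive⁻¹ ½)

  0≤p+q : ∀ {p q} → 0ℚ ℚ.≤ p → 0ℚ ℚ.≤ q → 0ℚ ℚ.≤ p ℚ.+ q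
  0≤p+q = ℚ.+-mono-≤

  0≤p*q : ∀ {p q} → 0ℚ ℚ.≤ p → 0ℚ ℚ.≤ q → 0ℚ ℚ.≤ p ℚ.* q
  0≤p*q {p} {q} 0≤p 0≤q =
    ℚ.nonNegative⁻¹ (p ℚ.* q) {{ℚ.nonNeg*nonNeg⇒nonNeg p {{ℚ.nonNegative 0≤p}} q {{ℚ.nonNegative 0≤q}}}}

  0≤q-p : ∀ {p q} → p ℚ.≤ q → 0ℚ ℚ.≤ q ℚ.- p
  0≤q-p {p} {q} p≤q = subst (ℚ._≤ q ℚ.- p) (ℚ.+-inverseʳ p) (ℚ.+-monoˡ-≤ (ℚ.- p) p≤q)

  ≤-by : ∀ {p q} r → 0ℚ ℚ.≤ r → q ≡ p ℚ.+ r → p ℚ.≤ q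
  ≤-by {p} r 0≤r q≡p+r = subst₂ ℚ._≤_ (ℚ.+-identityʳ p) (sym q≡p+r) (ℚ.+-monoʳ-≤ p 0≤r)

  p≤p+q : ∀ {p q} → 0ℚ ℚ.≤ q → p ℚ.≤ p ℚ.+ q
  p≤p+q {p} {q} 0≤q = ≤-by q 0≤q refl

  p≤q+p : ∀ {p q} → 0ℚ ℚ.≤ q → p ℚ.≤ q ℚ.+ p
  p≤q+p {p} {q} 0≤q = ≤-by q 0≤q (ℚ.+-comm q p)

  p+q-q≡p : ∀ p q → p ℚ.+ q ℚ.- q ≡ p
  p+q-q≡p = solve-∀ ℚ-ring

  *-monoˡ : ∀ {p q} r → 0ℚ ℚ.≤ r → p ℚ.≤ q → r ℚ.* p ℚ.≤ r ℚ.* q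
  *-monoˡ r 0≤r = ℚ.*-monoˡ-≤-nonNeg r {{ℚ.nonNegative 0≤r}}

  *-monoʳ : ∀ {p q} r → 0ℚ ℚ.≤ r → p ℚ.≤ q → p ℚ.* r ℚ.≤ q ℚ.* r
  *-monoʳ r 0≤r = ℚ.*-monoʳ-≤-nonNeg r {{ℚ.nonNegative 0≤r}}

  p≤∣p∣ : ∀ p → p ℚ.≤ ℚ.∣ p ∣
  p≤∣p∣ p with ℚ.≤-total 0ℚ p
  ... | inj₁ 0≤p = ℚ.≤-reflexive (sym (ℚ.0≤p⇒∣p∣≡p 0≤p))
  ... | inj₂ p≤0 = ℚ.≤-trans p≤0 (ℚ.0≤∣p∣ p)

  -p≤∣p∣ : ∀ p → ℚ.- p ℚ.≤ ℚ.∣ p ∣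
  -p≤∣p∣ p = subst (ℚ.- p ℚ.≤_) (ℚ.∣-p∣≡∣p∣ p) (p≤∣p∣ (ℚ.- p))

  ∣p∣≤ : ∀ {p q} → p ℚ.≤ q → ℚ.- p ℚ.≤ q → ℚ.∣ p ∣ ℚ.≤ q
  ∣p∣≤ {p} {q} p≤q -p≤q with ℚ.∣p∣≡p∨∣p∣≡-p p
  ... | inj₁ eq = subst (ℚ._≤ q) (sym eq) p≤q
  ... | inj₂ eq = subst (ℚ._≤ q) (sym eq) -p≤q

  ∣p-q∣≤∣p-r∣+∣r-q∣ : ∀ p q r → ℚ.∣ p ℚ.- q ∣ ℚ.≤ ℚ.∣ p ℚ.- r ∣ ℚ.+ ℚ.∣ r ℚ.- q ∣
  ∣p-q∣≤∣p-r∣+∣r-q∣ p q r = subst (ℚ._≤ ℚ.∣ p ℚ.- r ∣ ℚ.+ ℚ.∣ r ℚ.- q ∣)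
    (cong ℚ.∣_∣ (telescope p q r)) (ℚ.∣p+q∣≤∣p∣+∣q∣ (p ℚ.- r) (r ℚ.- q))
    where
    telescope : ∀ p q r → (p ℚ.- r) ℚ.+ (r ℚ.- q) ≡ p ℚ.- q
    telescope = solve-∀ ℚ-ring

  ∣p-p∣≡0 : ∀ p → ℚ.∣ p ℚ.- p ∣ ≡ 0ℚ
  ∣p-p∣≡0 p = cong ℚ.∣_∣ (ℚ.+-inverseʳ p)

-- Natural numbers as rationals

ι : ℕ → ℚ
ι zero    = 0ℚ
ι (suc n) = 1ℚ ℚ.+ ι n

abstract
  0≤ι : ∀ n → 0ℚ ℚ.≤ ι n
  0≤ι zero    = ℚ.≤-refl
  0≤ι (suc n) = 0≤p+q 0≤1 (0≤ι n)

  1≤ι : ∀ n → 1ℚ ℚ.≤ ι (suc n)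
  1≤ι n = p≤p+q (0≤ι n)

  ι-+ : ∀ m n → ι (m ℕ.+ n) ≡ ι m ℚ.+ ι n
  ι-+ zero    n = sym (ℚ.+-identityˡ (ι n))
  ι-+ (suc m) n = trans (cong (1ℚ ℚ.+_) (ι-+ m n)) (sym (ℚ.+-assoc 1ℚ (ι m) (ι n)))

  ι-* : ∀ m n → ι (m ℕ.* n) ≡ ι m ℚ.* ι n
  ι-* zero    n = sym (ℚ.*-zeroˡ (ι n))
  ι-* (suc m) n = trans (ι-+ n (m ℕ.* n)) (trans (cong (ι n ℚ.+_) (ι-* m n)) (distrib (ι m) (ι n)))
    where
    distrib : ∀ p q → q ℚ.+ p ℚ.* q ≡ (1ℚ ℚ.+ p) ℚ.* q
    distrib = solve-∀ ℚ-ring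

  ι-mono : ∀ {m n} → m ℕ.≤ n → ι m ℚ.≤ ι n
  ι-mono {n = n} ℕ.z≤n   = 0≤ι n
  ι-mono (ℕ.s≤s m≤n) = ℚ.+-monoʳ-≤ 1ℚ (ι-mono m≤n)

  toℚᵘ-ι : ∀ n → ℚ.toℚᵘ (ι n) ℚᵘ.≃ ℚᵘ.mkℚᵘ (ℤ.+ n) 0
  toℚᵘ-ι zero    = ℚᵘ.≃-refl
  toℚᵘ-ι (suc n) = ℚᵘ.≃-trans (ℚ.toℚᵘ-homo-+ 1ℚ (ι n))
    (ℚᵘ.≃-trans (ℚᵘ.+-congʳ ℚᵘ.1ℚᵘ (toℚᵘ-ι n)) (ℚᵘ.*≡* (cong (λ z → (ℤ.1ℤ ℤ.+ z) ℤ.* ℤ.1ℤ) (ℤ.*-identityʳ (ℤ.+ n)))))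

  -- The absolute value of the numerator will do, because the denominator is at least 1.
  archimedean : ∀ p → ∃[ n ] p ℚ.≤ ι n
  archimedean p@(mkℚ z d _) = ℤ.∣ z ∣ ,
    ℚ.toℚᵘ-cancel-≤ (ℚᵘ.≤-respʳ-≃ (ℚᵘ.≃-sym (toℚᵘ-ι ℤ.∣ z ∣)) (ℚᵘ.*≤* (bound z)))
    where
    bound : ∀ z → z ℤ.* ℤ.+ 1 ℤ.≤ ℤ.+ ℤ.∣ z ∣ ℤ.* ℤ.+ suc d
    bound z@(ℤ.+ n) = subst₂ ℤ._≤_ (ℤ.pos-* n 1) (ℤ.pos-* n (suc d))
      (ℤ.+≤+ (ℕ.*-monoʳ-≤ n (ℕ.s≤s ℕ.z≤n)))
    bound z@(ℤ.-[1+ n ]) = subst (z ℤ.* ℤ.+ 1 ℤ.≤_) (ℤ.pos-* (suc n) (suc d)) ℤ.-≤+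

-- Reciprocals of numbers that are at least 1

module _ {p} (1≤p : 1ℚ ℚ.≤ p) where

  private abstract
    positive : Positive p
    positive = ℚ.positive (ℚ.<-≤-trans (ℚ.positive⁻¹ 1ℚ) 1≤p)

  recip : ℚ
  recip = (ℚ.1/ p) {{ℚ.pos⇒nonZero p {{positive}}}}

  abstract
    *-recip : p ℚ.* recip ≡ 1ℚ
    *-recip = ℚ.*-inverseʳ p {{ℚ.pos⇒nonZero p {{positive}}}}

    0≤recip : 0ℚ ℚ.≤ recip
    0≤recip = ℚ.<⇒≤ (ℚ.positive⁻¹ recip {{ℚ.1/pos⇒pos p {{positive}}}})

    recip≤1 : recip ℚ.≤ 1ℚ
    recip≤1 = subst₂ ℚ._≤_ (ℚ.*-identityˡ recip) *-recip (*-monoʳ recip 0≤recip 1≤p)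

abstract
  -- The difference is (q - p)/(pq), and both reciprocals are at most 1. The Lipschitz constant 1
  -- lets `inv` keep the Cauchy modulus of its argument.
  ∣recip-recip∣≤ : ∀ {p q} (1≤p : 1ℚ ℚ.≤ p) (1≤q : 1ℚ ℚ.≤ q) →
    ℚ.∣ recip 1≤p ℚ.- recip 1≤q ∣ ℚ.≤ ℚ.∣ p ℚ.- q ∣
  ∣recip-recip∣≤ {p} {q} 1≤p 1≤q = begin
    ℚ.∣ p⁻¹ ℚ.- q⁻¹ ∣
      ≡⟨ cong ℚ.∣_∣ difference ⟩
    ℚ.∣ p⁻¹ ℚ.* q⁻¹ ℚ.* (q ℚ.- p) ∣
      ≡⟨ ℚ.∣p*q∣≡∣p∣*∣q∣ (p⁻¹ ℚ.* q⁻¹) (q ℚ.- p) ⟩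
    ℚ.∣ p⁻¹ ℚ.* q⁻¹ ∣ ℚ.* ℚ.∣ q ℚ.- p ∣
      ≡⟨ cong₂ ℚ._*_ (ℚ.0≤p⇒∣p∣≡p (0≤p*q (0≤recip 1≤p) (0≤recip 1≤q))) (Estimates.∣p-q∣≡∣q-p∣ q p) ⟩
    p⁻¹ ℚ.* q⁻¹ ℚ.* ℚ.∣ p ℚ.- q ∣
      ≤⟨ *-monoʳ ℚ.∣ p ℚ.- q ∣ (ℚ.0≤∣p∣ (p ℚ.- q)) (ℚ.≤-trans (*-monoˡ p⁻¹ (0≤recip 1≤p) (recip≤1 1≤q))
           (ℚ.≤-trans (ℚ.≤-reflexive (ℚ.*-identityʳ p⁻¹)) (recip≤1 1≤p))) ⟩
    1ℚ ℚ.* ℚ.∣ p ℚ.- q ∣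
      ≡⟨ ℚ.*-identityˡ ℚ.∣ p ℚ.- q ∣ ⟩
    ℚ.∣ p ℚ.- q ∣
      ∎
    where
    open ℚ.≤-Reasoning
    p⁻¹ q⁻¹ : ℚ
    p⁻¹ = recip 1≤p
    q⁻¹ = recip 1≤q
    regroup : ∀ p q r s → r ℚ.* s ℚ.* (q ℚ.- p) ≡ r ℚ.* (q ℚ.* s) ℚ.- s ℚ.* (p ℚ.* r)
    regroup = solve-∀ ℚ-ring
    difference : p⁻¹ ℚ.- q⁻¹ ≡ p⁻¹ ℚ.* q⁻¹ ℚ.* (q ℚ.- p)
    difference = sym (trans (regroup p q p⁻¹ q⁻¹)
      (cong₂ ℚ._-_ (trans (cong (p⁻¹ ℚ.*_) (*-recip 1≤q)) (ℚ.*-identityʳ p⁻¹))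
                   (trans (cong (q⁻¹ ℚ.*_) (*-recip 1≤p)) (ℚ.*-identityʳ q⁻¹))))

-- Real numbers

infix 4 _≐_

_≐_ : ℝ → ℝ → Set
x ≐ y = ∀ n → seq x n ≡ seq y n

abstract
  pointwise⇒≤ : ∀ x y → (∀ n → seq x n ℚ.≤ seq y n) → x ≤ y
  pointwise⇒≤ x y h ε = 0 , λ n _ → ℚ.≤-trans (h n) (Estimates.p≤p+ε (seq y n) ε)

  ≐⇒≤ : ∀ x y → x ≐ y → x ≤ y
  ≐⇒≤ x y x≐y = pointwise⇒≤ x y λ n → ℚ.≤-reflexive (x≐y n)

  ≐⇒≈ : ∀ x y → x ≐ y → x ≈ y
  ≐⇒≈ x y x≐y = ≐⇒≤ x y x≐y , ≐⇒≤ y x (λ n → sym (x≐y n))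

  ≤-trans : ∀ x y z → x ≤ y → y ≤ z → x ≤ z
  ≤-trans x y z x≤y y≤z ε
    with M , p ← x≤y (½ ℚ.* ε) {{ℚ.pos*pos⇒pos ½ ε}}
       | N , q ← y≤z (½ ℚ.* ε) {{ℚ.pos*pos⇒pos ½ ε}}
    = M ℕ.⊔ N , λ n K≤n → begin
      seq x n                                  ≤⟨ p n (ℕ.m⊔n≤o⇒m≤o M N K≤n) ⟩
      seq y n ℚ.+ ½ ℚ.* ε                      ≤⟨ ℚ.+-monoˡ-≤ (½ ℚ.* ε) (q n (ℕ.m⊔n≤o⇒n≤o M N K≤n)) ⟩
      seq z n ℚ.+ ½ ℚ.* ε ℚ.+ ½ ℚ.* ε          ≡⟨ ℚ.+-assoc (seq z n) (½ ℚ.* ε) (½ ℚ.* ε) ⟩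
      seq z n ℚ.+ (½ ℚ.* ε ℚ.+ ½ ℚ.* ε)        ≡⟨ cong (seq z n ℚ.+_) (Estimates.halves ε) ⟩
      seq z n ℚ.+ ε                            ∎
    where open ℚ.≤-Reasoning

  ≈-trans : ∀ x y z → x ≈ y → y ≈ z → x ≈ z
  ≈-trans x y z (x≤y , y≤x) (y≤z , z≤y) = ≤-trans x y z x≤y y≤z , ≤-trans z y x z≤y y≤x

  +-mono-≤ : ∀ x y u v → x ≤ y → u ≤ v → x + u ≤ y + v
  +-mono-≤ x y u v x≤y u≤v ε
    with M , p ← x≤y (½ ℚ.* ε) {{ℚ.pos*pos⇒pos ½ ε}}
       | N , q ← u≤v (½ ℚ.* ε) {{ℚ.pos*pos⇒pos ½ ε}}
    = M ℕ.⊔ N , λ n K≤n → begin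
      seq x n ℚ.+ seq u n
        ≤⟨ ℚ.+-mono-≤ (p n (ℕ.m⊔n≤o⇒m≤o M N K≤n)) (q n (ℕ.m⊔n≤o⇒n≤o M N K≤n)) ⟩
      (seq y n ℚ.+ ½ ℚ.* ε) ℚ.+ (seq v n ℚ.+ ½ ℚ.* ε)
        ≡⟨ regroup (seq y n) (seq v n) (½ ℚ.* ε) ⟩
      (seq y n ℚ.+ seq v n) ℚ.+ (½ ℚ.* ε ℚ.+ ½ ℚ.* ε)
        ≡⟨ cong (seq y n ℚ.+ seq v n ℚ.+_) (Estimates.halves ε) ⟩
      seq y n ℚ.+ seq v n ℚ.+ ε
        ∎
    where
    open ℚ.≤-Reasoning
    regroup : ∀ p q r → (p ℚ.+ r) ℚ.+ (q ℚ.+ r) ≡ (p ℚ.+ q) ℚ.+ (r ℚ.+ r)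
    regroup = solve-∀ ℚ-ring

  -- "Below" refers to the indices: this bounds the finitely many terms before `N` and complements
  -- the tail bound in `bounded`.
  bounded-below : ∀ (u : ℕ → ℚ) N → ∃[ K ] (∀ n → n ℕ.< N → u n ℚ.≤ ι K)
  bounded-below u zero    = 0 , λ _ ()
  bounded-below u (suc N) with bounded-below u N | archimedean (u N)
  ... | K , p | L , q = K ℕ.+ L , λ n n<1+N → below n (ℕ.m≤n⇒m<n∨m≡n (ℕ.s≤s⁻¹ n<1+N))
    where
    below : ∀ n → n ℕ.< N ⊎ n ≡ N → u n ℚ.≤ ι (K ℕ.+ L)
    below n (inj₁ n<N)  = ℚ.≤-trans (p n n<N) (ι-mono (ℕ.m≤m+n K L))
    below n (inj₂ refl) = ℚ.≤-trans q (ι-mono (ℕ.m≤n+m L K))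

  bounded : ∀ x → ∃[ K ] (∀ n → ℚ.∣ seq x n ∣ ℚ.≤ ι K)
  bounded x with cauchy-bounded {seq x} (cauchy x)
  ... | B , _ , N , tail with archimedean B | bounded-below (λ n → ℚ.∣ seq x n ∣) N
  ... | K , B≤K | L , initial = K ℕ.+ L , bound
    where
    bound : ∀ n → ℚ.∣ seq x n ∣ ℚ.≤ ι (K ℕ.+ L)
    bound n with n ℕ.<? N
    ... | yes n<N = ℚ.≤-trans (initial n n<N) (ι-mono (ℕ.m≤n+m L K))
    ... | no  n≮N = ℚ.≤-trans (tail n (ℕ.≮⇒≥ n≮N)) (ℚ.≤-trans B≤K (ι-mono (ℕ.m≤m+n K L)))

  -- A tolerance ε/B on x and y, with B a bound for all terms of z, becomes ε after the
  -- multiplication. This is what transports `S i ≈ s i` to the distances travelled.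
  *-monoˡ-≤ : ∀ x y z → (∀ n → 0ℚ ℚ.≤ seq z n) → x ≤ y → x * z ≤ y * z
  *-monoˡ-≤ x y z 0≤z x≤y ε = scaled (bounded z)
    where
    open ℚ.≤-Reasoning
    Goal : Set
    Goal = ∃[ N ] (∀ n → N ℕ.≤ n → seq (x * z) n ℚ.≤ seq (y * z) n ℚ.+ ε)

    close : ∀ B δ → 0ℚ ℚ.≤ δ → (∀ n → seq z n ℚ.≤ B) → B ℚ.* δ ≡ ε →
      ∃[ N ] (∀ n → N ℕ.≤ n → seq x n ℚ.≤ seq y n ℚ.+ δ) → Goal
    close B δ 0≤δ z≤B Bδ≡ε (N , p) = N , λ n N≤n → begin
      seq x n ℚ.* seq z n
        ≤⟨ *-monoʳ (seq z n) (0≤z n) (p n N≤n) ⟩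
      (seq y n ℚ.+ δ) ℚ.* seq z n
        ≡⟨ ℚ.*-distribʳ-+ (seq z n) (seq y n) δ ⟩
      seq y n ℚ.* seq z n ℚ.+ δ ℚ.* seq z n
        ≤⟨ ℚ.+-monoʳ-≤ (seq y n ℚ.* seq z n) (*-monoˡ δ 0≤δ (z≤B n)) ⟩
      seq y n ℚ.* seq z n ℚ.+ δ ℚ.* B
        ≡⟨ cong (seq y n ℚ.* seq z n ℚ.+_) (trans (ℚ.*-comm δ B) Bδ≡ε) ⟩
      seq y n ℚ.* seq z n ℚ.+ ε
        ∎

    rescaled : ∀ B → (∀ n → seq z n ℚ.≤ B) → ∃[ δ ] (Positive δ × B ℚ.* δ ≡ ε) → Goal
    rescaled B z≤B (δ , δ>0 , Bδ≡ε) =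
      close B δ (ℚ.<⇒≤ (ℚ.positive⁻¹ δ {{δ>0}})) z≤B Bδ≡ε (x≤y δ {{δ>0}})

    scaled : ∃[ K ] (∀ n → ℚ.∣ seq z n ∣ ℚ.≤ ι K) → Goal
    scaled (K , z≤K) = rescaled (1ℚ ℚ.+ ι K)
      (λ n → ℚ.≤-trans (ℚ.≤-trans (p≤∣p∣ (seq z n)) (z≤K n)) (p≤q+p 0≤1))
      (Estimates.scale (1ℚ ℚ.+ ι K) {{ℚ.positive (ℚ.<-≤-trans (ℚ.positive⁻¹ 1ℚ) (1≤ι K))}} ε)

const : ℚ → ℝ
const q = mkℝ (λ _ → q) (const-cauchy q)

abstract
  inv-cauchy : ∀ {u} (1≤u : ∀ n → 1ℚ ℚ.≤ u n) → IsCauchy u → IsCauchy (λ n → recip (1≤u n))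
  inv-cauchy 1≤u cu ε with N , p ← cu ε = N , λ m n N≤m N≤n →
    ℚ.≤-trans (∣recip-recip∣≤ (1≤u m) (1≤u n)) (p m n N≤m N≤n)

inv : ∀ x → (∀ n → 1ℚ ℚ.≤ seq x n) → ℝ
inv x 1≤x = mkℝ (λ n → recip (1≤x n)) (inv-cauchy {seq x} 1≤x (cauchy x))

-- The maximum of 1 and x by a closed formula, so that no comparison of reals is needed and the
-- Cauchy property is inherited from the arithmetic operations.
max1 : ℝ → ℝ
max1 x = const ½ * (1ℝ + x + ∣ x - 1ℝ ∣)

abstract
  1≤max1 : ∀ x n → 1ℚ ℚ.≤ seq (max1 x) n
  1≤max1 x n = ≤-by (½ ℚ.* (ℚ.∣ p ℚ.- 1ℚ ∣ ℚ.- (ℚ.- (p ℚ.- 1ℚ))))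
    (0≤p*q 0≤½ (0≤q-p (-p≤∣p∣ (p ℚ.- 1ℚ)))) (eq p ℚ.∣ p ℚ.- 1ℚ ∣)
    where
    p : ℚ
    p = seq x n
    eq : ∀ p q → ½ ℚ.* (1ℚ ℚ.+ p ℚ.+ q) ≡ 1ℚ ℚ.+ ½ ℚ.* (q ℚ.- (ℚ.- (p ℚ.- 1ℚ)))
    eq = solve-∀ ℚ-ring

  max1≈ : ∀ x → 1ℝ ≤ x → max1 x ≈ x
  max1≈ x 1≤x = upper , pointwise⇒≤ x (max1 x) lower
    where
    open ℚ.≤-Reasoning
    eq : ∀ p q → ½ ℚ.* (1ℚ ℚ.+ p ℚ.+ q) ≡ p ℚ.+ ½ ℚ.* (q ℚ.- (p ℚ.- 1ℚ))
    eq = solve-∀ ℚ-ring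
    lower : ∀ n → seq x n ℚ.≤ seq (max1 x) n
    lower n = ≤-by (½ ℚ.* (ℚ.∣ seq x n ℚ.- 1ℚ ∣ ℚ.- (seq x n ℚ.- 1ℚ)))
      (0≤p*q 0≤½ (0≤q-p (p≤∣p∣ (seq x n ℚ.- 1ℚ)))) (eq (seq x n) ℚ.∣ seq x n ℚ.- 1ℚ ∣)
    cancel : ∀ p ε → ½ ℚ.* ((p ℚ.- 1ℚ ℚ.+ (ε ℚ.+ ε)) ℚ.- (p ℚ.- 1ℚ)) ≡ ε
    cancel = solve-∀ ℚ-ring
    -- The slack is 2ε because the factor ½ in `max1` halves it.
    near : ∀ p ε → 0ℚ ℚ.≤ ε → 1ℚ ℚ.≤ p ℚ.+ ε → ℚ.∣ p ℚ.- 1ℚ ∣ ℚ.≤ p ℚ.- 1ℚ ℚ.+ (ε ℚ.+ ε)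
    near p ε 0≤ε 1≤p+ε = ∣p∣≤ (p≤p+q (0≤p+q 0≤ε 0≤ε))
      (≤-by ((p ℚ.+ ε ℚ.- 1ℚ) ℚ.+ (p ℚ.+ ε ℚ.- 1ℚ)) (0≤p+q (0≤q-p 1≤p+ε) (0≤q-p 1≤p+ε)) (expand p ε))
      where
      expand : ∀ p ε → p ℚ.- 1ℚ ℚ.+ (ε ℚ.+ ε) ≡
        ℚ.- (p ℚ.- 1ℚ) ℚ.+ ((p ℚ.+ ε ℚ.- 1ℚ) ℚ.+ (p ℚ.+ ε ℚ.- 1ℚ))
      expand = solve-∀ ℚ-ring
    upper : max1 x ≤ x
    upper ε with 1≤x ε
    ... | N , h = N , λ n N≤n → begin
      ½ ℚ.* (1ℚ ℚ.+ seq x n ℚ.+ ℚ.∣ seq x n ℚ.- 1ℚ ∣)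
        ≡⟨ eq (seq x n) ℚ.∣ seq x n ℚ.- 1ℚ ∣ ⟩
      seq x n ℚ.+ ½ ℚ.* (ℚ.∣ seq x n ℚ.- 1ℚ ∣ ℚ.- (seq x n ℚ.- 1ℚ))
        ≤⟨ ℚ.+-monoʳ-≤ (seq x n) (*-monoˡ ½ 0≤½ (ℚ.+-monoˡ-≤ (ℚ.- (seq x n ℚ.- 1ℚ))
             (near (seq x n) ε (ℚ.<⇒≤ (ℚ.positive⁻¹ ε)) (h n N≤n)))) ⟩
      seq x n ℚ.+ ½ ℚ.* ((seq x n ℚ.- 1ℚ ℚ.+ (ε ℚ.+ ε)) ℚ.- (seq x n ℚ.- 1ℚ))
        ≡⟨ cong (seq x n ℚ.+_) (cancel (seq x n) ε) ⟩
      seq x n ℚ.+ ε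
        ∎

-- Offline solutions

0≤∑< : ∀ N {f n} → (∀ j → 0ℚ ℚ.≤ seq (f j) n) → 0ℚ ℚ.≤ seq (∑< N f) n
0≤∑< zero    0≤f = ℚ.≤-refl
0≤∑< (suc N) 0≤f = 0≤p+q (0≤∑< N 0≤f) (0≤f N)

∑<-mono : ∀ N {f g} → (∀ j → j ℕ.< N → f j ≤ g j) → ∑< N f ≤ ∑< N g
∑<-mono zero    f≤g = ≤-refl 0ℝ
∑<-mono (suc N) {f} {g} f≤g = +-mono-≤ (∑< N f) (∑< N g) (f N) (g N)
  (∑<-mono N λ j j<N → f≤g j (ℕ.m≤n⇒m≤1+n j<N)) (f≤g N ℕ.≤-refl)

∑<-+ : ∀ N f g → ∑< N (λ j → f j + g j) ≐ ∑< N f + ∑< N g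
∑<-+ zero    f g n = refl
∑<-+ (suc N) f g n = trans (cong (ℚ._+ (seq (f N) n ℚ.+ seq (g N) n)) (∑<-+ N f g n))
  (regroup (seq (∑< N f) n) (seq (∑< N g) n) (seq (f N) n) (seq (g N) n))
  where
  regroup : ∀ p q r s → p ℚ.+ q ℚ.+ (r ℚ.+ s) ≡ p ℚ.+ r ℚ.+ (q ℚ.+ s)
  regroup = solve-∀ ℚ-ring

-- A single summand absorbs the extra `u`. In the application, `u` is the cost of a lazy move and
-- `j` the server that makes it.
∑<-replace : ∀ N {f g} u j → j ℕ.< N → (∀ i → i ≢ j → f i ≤ g i) → u + f j ≤ g j →
  u + ∑< N f ≤ ∑< N g
∑<-replace (suc N) {f} {g} u j j<1+N f≤g u+f≤g with ℕ.m≤n⇒m<n∨m≡n (ℕ.s≤s⁻¹ j<1+N)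
... | inj₁ j<N = ≤-trans (u + (∑< N f + f N)) (u + ∑< N f + f N) (∑< N g + g N)
  (≐⇒≤ (u + (∑< N f + f N)) (u + ∑< N f + f N)
    λ n → sym (ℚ.+-assoc (seq u n) (seq (∑< N f) n) (seq (f N) n)))
  (+-mono-≤ (u + ∑< N f) (∑< N g) (f N) (g N) (∑<-replace N u j j<N f≤g u+f≤g)
    (f≤g N λ N≡j → ℕ.<-irrefl (sym N≡j) j<N))
... | inj₂ refl = ≤-trans (u + (∑< N f + f N)) (∑< N f + (u + f N)) (∑< N g + g N)
  (≐⇒≤ (u + (∑< N f + f N)) (∑< N f + (u + f N))
    λ n → regroup (seq u n) (seq (∑< N f) n) (seq (f N) n))
  (+-mono-≤ (∑< N f) (∑< N g) (u + f N) (g N)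
    (∑<-mono N λ i i<N → f≤g i λ i≡N → ℕ.<-irrefl i≡N i<N) u+f≤g)
  where
  regroup : ∀ p q r → p ℚ.+ (q ℚ.+ r) ≡ q ℚ.+ (p ℚ.+ r)
  regroup = solve-∀ ℚ-ring

∣x-y∣≤0 : ∀ x y → x ≈ y → ∣ x - y ∣ ≤ 0ℝ
∣x-y∣≤0 x y (x≤y , y≤x) ε with x≤y ε | y≤x ε
... | M , p | N , q = M ℕ.⊔ N , λ n K≤n → subst (ℚ.∣ seq x n ℚ.- seq y n ∣ ℚ.≤_) (sym (ℚ.+-identityˡ ε))
  (∣p∣≤ (difference (seq x n) (seq y n) (p n (ℕ.m⊔n≤o⇒m≤o M N K≤n)))
        (subst (ℚ._≤ ε) (sym (Estimates.neg-sub (seq x n) (seq y n)))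
          (difference (seq y n) (seq x n) (q n (ℕ.m⊔n≤o⇒n≤o M N K≤n)))))
  where
  difference : ∀ a b → a ℚ.≤ b ℚ.+ ε → a ℚ.- b ℚ.≤ ε
  difference a b a≤b+ε = subst (a ℚ.- b ℚ.≤_) (Estimates.add-sub′ b ε) (ℚ.+-monoˡ-≤ (ℚ.- b) a≤b+ε)

-- Servers from `N` on contribute summands that are at most 0 up to any tolerance. A travel cost can
-- thus be padded to a range `B` shared by all steps of a run.
∑<-tail : ∀ {x x′ : Config} {N} B → N ℕ.≤ B → (∀ j → N ℕ.≤ j → pos (x′ j) ≈ pos (x j)) →
  ∑< B (λ j → ∣ pos (x′ j) - pos (x j) ∣) ≤ ∑< N (λ j → ∣ pos (x′ j) - pos (x j) ∣)
∑<-tail {N = zero}  zero    _     _    = ≤-refl 0ℝ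
∑<-tail {x} {x′} {N} (suc B) N≤1+B same with ℕ.m≤n⇒m<n∨m≡n N≤1+B
... | inj₂ refl  = ≤-refl (∑< N (λ j → ∣ pos (x′ j) - pos (x j) ∣))
... | inj₁ N<1+B = ≤-trans (∑< B f + f B) (∑< N f + 0ℝ) (∑< N f)
  (+-mono-≤ (∑< B f) (∑< N f) (f B) 0ℝ (∑<-tail {x} {x′} B (ℕ.s≤s⁻¹ N<1+B) same)
    (∣x-y∣≤0 (pos (x′ B)) (pos (x B)) (same B (ℕ.s≤s⁻¹ N<1+B))))
  (≐⇒≤ (∑< N f + 0ℝ) (∑< N f) λ n → ℚ.+-identityʳ (seq (∑< N f) n))
  where
  f : ℕ → ℝ
  f j = ∣ pos (x′ j) - pos (x j) ∣

-- Modified configurations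

abstract
  over : {P : ℕ → Set} → (∀ j → Dec (P j)) → Config → Config → Config
  over P? f x j = if does (P? j) then f j else x j

  over-yes : ∀ {P : ℕ → Set} (P? : ∀ j → Dec (P j)) f x {j} → P j → over P? f x j ≡ f j
  over-yes P? f x {j} Pj with P? j
  ... | yes _  = refl
  ... | no ¬Pj = contradiction Pj ¬Pj

  over-no : ∀ {P : ℕ → Set} (P? : ∀ j → Dec (P j)) f x {j} → ¬ P j → over P? f x j ≡ x j
  over-no P? f x {j} ¬Pj with P? j
  ... | yes Pj = contradiction Pj ¬Pj
  ... | no _   = refl

put : Config → ℕ → Point → Config
put x i r = over (ℕ._≟ i) (λ _ → r) x

put-≡ : ∀ x i r → put x i r i ≡ r
put-≡ x i r = over-yes (ℕ._≟ i) (λ _ → r) x refl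

put-≢ : ∀ x i r {j} → j ≢ i → put x i r j ≡ x j
put-≢ x i r = over-no (ℕ._≟ i) (λ _ → r) x

∑<-zero : ∀ N {f} n → (∀ j → j ℕ.< N → seq (f j) n ≡ 0ℚ) → seq (∑< N f) n ≡ 0ℚ
∑<-zero zero    n f≡0 = refl
∑<-zero (suc N) n f≡0 =
  cong₂ ℚ._+_ (∑<-zero N n λ j j<N → f≡0 j (ℕ.m≤n⇒m≤1+n j<N)) (f≡0 N ℕ.≤-refl)

≡⇒≈ : ∀ {a b : Point} → a ≡ b → pos a ≈ pos b
≡⇒≈ {a} refl = ≤-refl (pos a) , ≤-refl (pos a)

put-travel : ∀ x i r → Travel x (put x i r) ∣ pos r - pos (x i) ∣
put-travel x i r = suc i ,
  (λ j i<j → ≡⇒≈ (put-≢ x i r λ j≡i → ℕ.<-irrefl (sym j≡i) i<j)) ,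
  ≐⇒≈ ∣ pos r - pos (x i) ∣ (∑< (suc i) f) λ n → sym (trans
    (cong₂ ℚ._+_ (∑<-zero i {f} n λ j j<i → trans
        (cong (λ a → ℚ.∣ seq (pos a) n ℚ.- seq (pos (x j)) n ∣)
          (put-≢ x i r λ j≡i → ℕ.<-irrefl j≡i j<i))
        (∣p-p∣≡0 (seq (pos (x j)) n)))
      (cong (λ a → ℚ.∣ seq (pos a) n ℚ.- seq (pos (x i)) n ∣) (put-≡ x i r)))
    (ℚ.+-identityˡ ℚ.∣ seq (pos r) n ℚ.- seq (pos (x i)) n ∣))
  where
  f : ℕ → ℝ
  f j = ∣ pos (put x i r j) - pos (x j) ∣

-- Finite minima

min : ℝ → ℝ → ℝ
min x y = const ½ * (x + y - ∣ x - y ∣)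

-- The selected argument may vary with the index; a uniform choice would decide the order of two
-- reals.
min-sel : ∀ x y n → seq (min x y) n ≡ seq x n × seq x n ℚ.≤ seq y n ⊎
                    seq (min x y) n ≡ seq y n × seq y n ℚ.≤ seq x n
min-sel x y n with ℚ.≤-total (seq x n) (seq y n)
... | inj₁ x≤y = inj₁ (trans (cong (λ q → ½ ℚ.* (seq x n ℚ.+ seq y n ℚ.- q))
        (trans (Estimates.∣p-q∣≡∣q-p∣ (seq x n) (seq y n)) (ℚ.0≤p⇒∣p∣≡p (0≤q-p x≤y))))
      (halve (seq x n) (seq y n)) , x≤y)
  where
  halve : ∀ p q → ½ ℚ.* (p ℚ.+ q ℚ.- (q ℚ.- p)) ≡ p
  halve = solve-∀ ℚ-ring
... | inj₂ y≤x = inj₂ (trans (cong (λ q → ½ ℚ.* (seq x n ℚ.+ seq y n ℚ.- q))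
        (ℚ.0≤p⇒∣p∣≡p (0≤q-p y≤x)))
      (halve (seq x n) (seq y n)) , y≤x)
  where
  halve : ∀ p q → ½ ℚ.* (p ℚ.+ q ℚ.- (p ℚ.- q)) ≡ q
  halve = solve-∀ ℚ-ring

min≤ˡ : ∀ x y n → seq (min x y) n ℚ.≤ seq x n
min≤ˡ x y n with min-sel x y n
... | inj₁ (eq , _)   = ℚ.≤-reflexive eq
... | inj₂ (eq , y≤x) = subst (ℚ._≤ seq x n) (sym eq) y≤x

min≤ʳ : ∀ x y n → seq (min x y) n ℚ.≤ seq y n
min≤ʳ x y n with min-sel x y n
... | inj₁ (eq , x≤y) = subst (ℚ._≤ seq y n) (sym eq) x≤y
... | inj₂ (eq , _)   = ℚ.≤-reflexive eq

min-glb : ∀ w x y → w ≤ x → w ≤ y → w ≤ min x y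
min-glb w x y w≤x w≤y ε with w≤x ε | w≤y ε
... | M , p | N , q = M ℕ.⊔ N , λ n K≤n → select n (p n (ℕ.m⊔n≤o⇒m≤o M N K≤n)) (q n (ℕ.m⊔n≤o⇒n≤o M N K≤n))
  where
  select : ∀ n → seq w n ℚ.≤ seq x n ℚ.+ ε → seq w n ℚ.≤ seq y n ℚ.+ ε →
    seq w n ℚ.≤ seq (min x y) n ℚ.+ ε
  select n p q with min-sel x y n
  ... | inj₁ (eq , _) = subst (λ r → seq w n ℚ.≤ r ℚ.+ ε) (sym eq) p
  ... | inj₂ (eq , _) = subst (λ r → seq w n ℚ.≤ r ℚ.+ ε) (sym eq) q

minimum : ℕ → (ℕ → ℝ) → ℝ
minimum zero    f = f 0
minimum (suc N) f = min (minimum N f) (f (suc N))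

minimum-≤ : ∀ N f j → j ℕ.≤ N → ∀ n → seq (minimum N f) n ℚ.≤ seq (f j) n
minimum-≤ zero    f zero j≤0 n = ℚ.≤-refl
minimum-≤ (suc N) f j j≤1+N n with ℕ.m≤n⇒m<n∨m≡n j≤1+N
... | inj₁ j<1+N = ℚ.≤-trans (min≤ˡ (minimum N f) (f (suc N)) n) (minimum-≤ N f j (ℕ.s≤s⁻¹ j<1+N) n)
... | inj₂ refl  = min≤ʳ (minimum N f) (f (suc N)) n

minimum-glb : ∀ N f w → (∀ j → w ≤ f j) → w ≤ minimum N f
minimum-glb zero    f w w≤f = w≤f 0
minimum-glb (suc N) f w w≤f = min-glb w (minimum N f) (f (suc N)) (minimum-glb N f w w≤f) (w≤f (suc N))

minimum-nonneg : ∀ N f n → (∀ j → 0ℚ ℚ.≤ seq (f j) n) → 0ℚ ℚ.≤ seq (minimum N f) n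
minimum-nonneg zero    f n 0≤f = 0≤f 0
minimum-nonneg (suc N) f n 0≤f with min-sel (minimum N f) (f (suc N)) n
... | inj₁ (eq , _) = subst (0ℚ ℚ.≤_) (sym eq) (minimum-nonneg N f n 0≤f)
... | inj₂ (eq , _) = subst (0ℚ ℚ.≤_) (sym eq) (0≤f (suc N))

-- Lazy strategies and the value of OPT

lazyCost : Config → (ℕ → ℕ) → List Point → ℝ
lazyCost p js []      = 0ℝ
lazyCost p js (r ∷ σ) = ∣ pos r - pos (p (js 0)) ∣ + lazyCost (put p (js 0) r) (λ k → js (suc k)) σ

-- The minimum over the lazy strategies that use the servers in the order of their
-- indices: at most N of them have left the source, so server N stands for all the rest.
opt : ℕ → Config → List Point → ℝ
opt N p []      = 0ℝ
opt N p (r ∷ σ) = minimum N λ j → ∣ pos r - pos (p j) ∣ + opt (suc N) (put p j r) σ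

opt-nonneg : ∀ N p σ n → 0ℚ ℚ.≤ seq (opt N p σ) n
opt-nonneg N p []      n = ℚ.≤-refl
opt-nonneg N p (r ∷ σ) n = minimum-nonneg N
  (λ j → ∣ pos r - pos (p j) ∣ + opt (suc N) (put p j r) σ) n
  λ j → 0≤p+q (ℚ.0≤∣p∣ (seq (pos r) n ℚ.- seq (pos (p j)) n)) (opt-nonneg (suc N) (put p j r) σ n)

-- The names of the servers are immaterial. Injectivity guarantees that moving `τ (js 0)` affects
-- the image of no other server.
lazyCost-relabel : ∀ {p q} (τ : ℕ → ℕ) → (∀ {i j} → τ i ≡ τ j → i ≡ j) →
  (∀ j → pos (q (τ j)) ≐ pos (p j)) → ∀ js σ → lazyCost q (λ k → τ (js k)) σ ≐ lazyCost p js σ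
lazyCost-relabel τ inj q≐p js []      n = refl
lazyCost-relabel {p} {q} τ inj q≐p js (r ∷ σ) n = cong₂ ℚ._+_
  (cong (λ a → ℚ.∣ seq (pos r) n ℚ.- a ∣) (q≐p (js 0) n))
  (lazyCost-relabel τ inj moved (λ k → js (suc k)) σ n)
  where
  moved : ∀ j → pos (put q (τ (js 0)) r (τ j)) ≐ pos (put p (js 0) r j)
  moved j n with j ℕ.≟ js 0
  ... | yes refl = cong (λ a → seq (pos a) n) (trans (put-≡ q (τ j) r) (sym (put-≡ p j r)))
  ... | no j≢j₀  = trans
    (cong (λ a → seq (pos a) n) (put-≢ q (τ (js 0)) r λ τj≡τj₀ → j≢j₀ (inj τj≡τj₀)))
    (trans (q≐p j n) (cong (λ a → seq (pos a) n) (sym (put-≢ p (js 0) r j≢j₀))))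

swap : ℕ → ℕ → ℕ → ℕ
swap a b j with j ℕ.≟ a | j ℕ.≟ b
... | yes _ | _     = b
... | no _  | yes _ = a
... | no _  | no _  = j

swap-involutive : ∀ a b j → swap a b (swap a b j) ≡ j
swap-involutive a b j with j ℕ.≟ a | j ℕ.≟ b
swap-involutive a b j | yes refl | _ with b ℕ.≟ j | b ℕ.≟ b
... | yes b≡j | _      = b≡j
... | no _    | yes _  = refl
... | no _    | no b≢b = contradiction refl b≢b
swap-involutive a b j | no _ | yes refl with a ℕ.≟ a
... | yes _  = refl
... | no a≢a = contradiction refl a≢a
swap-involutive a b j | no j≢a | no j≢b with j ℕ.≟ a | j ℕ.≟ b
... | yes j≡a | _       = contradiction j≡a j≢a
... | no _    | yes j≡b = contradiction j≡b j≢b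
... | no _    | no _    = refl

swap-injective : ∀ a b {i j} → swap a b i ≡ swap a b j → i ≡ j
swap-injective a b {i} {j} eq =
  trans (sym (swap-involutive a b i)) (trans (cong (swap a b) eq) (swap-involutive a b j))

-- If `js 0` exceeds `N`, then it stands at the source together with server `N`, so the two can
-- exchange names for the rest of the sequence.
opt≤lazyCost : ∀ N p js σ → (∀ j → N ℕ.≤ j → pos (p j) ≐ 0ℝ) → ∀ n →
  seq (opt N p σ) n ℚ.≤ seq (lazyCost p js σ) n
opt≤lazyCost N p js []      fresh n = ℚ.≤-refl
opt≤lazyCost N p js (r ∷ σ) fresh n with js 0 ℕ.≤? N
... | yes j≤N = ℚ.≤-trans (minimum-≤ N choice (js 0) j≤N n)
  (ℚ.+-monoʳ-≤ (seq ∣ pos r - pos (p (js 0)) ∣ n)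
    (opt≤lazyCost (suc N) (put p (js 0) r) (λ k → js (suc k)) σ
      (λ j N<j n → trans (cong (λ a → seq (pos a) n)
          (put-≢ p (js 0) r λ j≡j₀ → ℕ.<-irrefl (sym j≡j₀) (ℕ.≤-<-trans j≤N N<j)))
        (fresh j (ℕ.<⇒≤ N<j) n)) n))
  where
  choice : ℕ → ℝ
  choice j = ∣ pos r - pos (p j) ∣ + opt (suc N) (put p j r) σ
... | no j≰N = ℚ.≤-trans (minimum-≤ N choice N ℕ.≤-refl n)
  (ℚ.≤-trans (ℚ.+-monoʳ-≤ (seq ∣ pos r - pos (p N) ∣ n)
      (opt≤lazyCost (suc N) (put p N r) (λ k → τ (js (suc k))) σ
        (λ j N<j n → trans (cong (λ a → seq (pos a) n)
            (put-≢ p N r λ j≡N → ℕ.<-irrefl (sym j≡N) N<j))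
          (fresh j (ℕ.<⇒≤ N<j) n)) n))
    (ℚ.≤-reflexive (cong₂ ℚ._+_
      (cong (λ a → ℚ.∣ seq (pos r) n ℚ.- a ∣)
        (trans (fresh N ℕ.≤-refl n) (sym (fresh (js 0) N≤j₀ n))))
      (lazyCost-relabel τ (swap-injective (js 0) N) moved (λ k → js (suc k)) σ n))))
  where
  N≤j₀ : N ℕ.≤ js 0
  N≤j₀ = ℕ.<⇒≤ (ℕ.≰⇒> j≰N)
  τ : ℕ → ℕ
  τ = swap (js 0) N
  choice : ℕ → ℝ
  choice j = ∣ pos r - pos (p j) ∣ + opt (suc N) (put p j r) σ
  moved : ∀ j → pos (put p N r (τ j)) ≐ pos (put p (js 0) r j)
  moved j n with j ℕ.≟ js 0 | j ℕ.≟ N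
  ... | yes refl | _ = cong (λ a → seq (pos a) n) (trans (put-≡ p N r) (sym (put-≡ p j r)))
  ... | no j≢j₀ | yes refl = trans
    (cong (λ a → seq (pos a) n) (put-≢ p N r (λ j₀≡N → j≢j₀ (sym j₀≡N))))
    (trans (trans (fresh (js 0) N≤j₀ n) (sym (fresh N ℕ.≤-refl n)))
      (cong (λ a → seq (pos a) n) (sym (put-≢ p (js 0) r j≢j₀))))
  ... | no j≢j₀ | no j≢N =
    cong (λ a → seq (pos a) n) (trans (put-≢ p N r j≢N) (sym (put-≢ p (js 0) r j≢j₀)))

cons : ℕ → (ℕ → ℕ) → ℕ → ℕ
cons j js zero    = j
cons j js (suc k) = js k

distances : ℕ → Config → Config → ℝ
distances B x p = ∑< B λ i → ∣ pos (x i) - pos (p i) ∣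

-- A potential argument: the lazy server `j` goes straight to where server `j` of the run now is, so
-- its distance drops to 0. By the triangle inequality, the old distance and the move of the run pay
-- for this.
distances-put : ∀ B {x x′ : Config} {p r j} → j ℕ.< B → pos (x′ j) ≈ pos r →
  ∣ pos r - pos (p j) ∣ + distances B x′ (put p j r) ≤ distances B x p + distances B x′ x
distances-put B {x} {x′} {p} {r} {j} j<B x′≈r =
  ≤-trans (u + ∑< B f) (∑< B λ i → g i + h i) (∑< B g + ∑< B h)
    (∑<-replace B u j j<B others here)
    (≐⇒≤ (∑< B λ i → g i + h i) (∑< B g + ∑< B h) (∑<-+ B g h))
  where
  u : ℝ
  u = ∣ pos r - pos (p j) ∣
  f g h : ℕ → ℝ
  f i = ∣ pos (x′ i) - pos (put p j r i) ∣
  g i = ∣ pos (x i) - pos (p i) ∣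
  h i = ∣ pos (x′ i) - pos (x i) ∣

  triangle : ∀ i n → seq ∣ pos (x′ i) - pos (p i) ∣ n ℚ.≤ seq (g i + h i) n
  triangle i n = ℚ.≤-trans
    (∣p-q∣≤∣p-r∣+∣r-q∣ (seq (pos (x′ i)) n) (seq (pos (p i)) n) (seq (pos (x i)) n))
    (ℚ.≤-reflexive (ℚ.+-comm (seq (h i) n) (seq (g i) n)))

  others : ∀ i → i ≢ j → f i ≤ g i + h i
  others i i≢j = pointwise⇒≤ (f i) (g i + h i) λ n → subst
    (λ a → ℚ.∣ seq (pos (x′ i)) n ℚ.- seq (pos a) n ∣ ℚ.≤ seq (g i + h i) n)
    (sym (put-≢ p j r i≢j)) (triangle i n)

  miss : ∣ pos (x′ j) - pos r ∣ ≤ 0ℝ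
  miss = ∣x-y∣≤0 (pos (x′ j)) (pos r) x′≈r

  detour : ∀ n → seq (u + f j) n ℚ.≤
    seq (∣ pos (x′ j) - pos r ∣ + ∣ pos (x′ j) - pos r ∣ + (g j + h j)) n
  detour n = ℚ.≤-trans
    (ℚ.+-mono-≤ (ℚ.≤-trans (∣p-q∣≤∣p-r∣+∣r-q∣ (seq (pos r) n) (seq (pos (p j)) n) (seq (pos (x′ j)) n))
        (ℚ.+-mono-≤ (ℚ.≤-reflexive (Estimates.∣p-q∣≡∣q-p∣ (seq (pos r) n) (seq (pos (x′ j)) n)))
                    (triangle j n)))
      (ℚ.≤-reflexive (cong (λ a → ℚ.∣ seq (pos (x′ j)) n ℚ.- seq (pos a) n ∣) (put-≡ p j r))))
    (ℚ.≤-reflexive (regroup (seq ∣ pos (x′ j) - pos r ∣ n) (seq (g j + h j) n)))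
    where
    regroup : ∀ p q → p ℚ.+ q ℚ.+ p ≡ p ℚ.+ p ℚ.+ q
    regroup = solve-∀ ℚ-ring

  here : u + f j ≤ g j + h j
  here = ≤-trans (u + f j) (m + m + (g j + h j)) (g j + h j)
    (pointwise⇒≤ (u + f j) (m + m + (g j + h j)) detour)
    (≤-trans (m + m + (g j + h j)) (0ℝ + 0ℝ + (g j + h j)) (g j + h j)
      (+-mono-≤ (m + m) (0ℝ + 0ℝ) (g j + h j) (g j + h j) (+-mono-≤ m 0ℝ m 0ℝ miss miss) (≤-refl (g j + h j)))
      (≐⇒≤ (0ℝ + 0ℝ + (g j + h j)) (g j + h j) λ n → ℚ.+-identityˡ (seq (g j + h j) n)))
    where
    m : ℝ
    m = ∣ pos (x′ j) - pos r ∣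

-- The potential `distances B x p` records the moves that the lazy strategy has postponed; each is
-- made up for at the latest when its server serves. `B₀` is large enough to cover every server that
-- moves or serves in the run.
lazyCost≤run : ∀ {x σ d} → Run Serves x σ d →
  ∃[ js ] ∃[ B₀ ] (∀ p B → B₀ ℕ.≤ B → lazyCost p js σ ≤ d + distances B x p)
lazyCost≤run {x} (done {c = c} (_ , 0≤c)) = (λ _ → 0) , 0 , λ p B _ →
  ≤-trans 0ℝ (c + 0ℝ) (c + distances B x p)
    (≤-trans 0ℝ c (c + 0ℝ) 0≤c (≐⇒≤ c (c + 0ℝ) λ n → sym (ℚ.+-identityʳ (seq c n))))
    (+-mono-≤ c c 0ℝ (distances B x p) (≤-refl c) (pointwise⇒≤ 0ℝ (distances B x p)
      λ n → 0≤∑< B {λ i → ∣ pos (x i) - pos (p i) ∣} λ i → ℚ.0≤∣p∣ (seq (pos (x i)) n ℚ.- seq (pos (p i)) n)))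
lazyCost≤run {x} (serve {x′ = x′} {r} {σ} {d} {e} {c} (j , x′≈r) (N , same , _ , ∑≤d) run (_ , d+e≤c))
  with lazyCost≤run run
... | js , B₀ , bound = cons j js , B₀ ℕ.⊔ (N ℕ.⊔ suc j) , λ p B B₁≤B →
  let B₀≤B = ℕ.m⊔n≤o⇒m≤o B₀ (N ℕ.⊔ suc j) B₁≤B
      N⊔j<B = ℕ.m⊔n≤o⇒n≤o B₀ (N ℕ.⊔ suc j) B₁≤B
      u = ∣ pos r - pos (p j) ∣
      l = lazyCost (put p j r) js σ
      δ = distances B x p
      δ′ = distances B x′ (put p j r)
      m = distances B x′ x
      m≤d = ≤-trans m (distances N x′ x) d (∑<-tail {x} {x′} B (ℕ.m⊔n≤o⇒m≤o N (suc j) N⊔j<B) same) ∑≤d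
  in ≤-trans (u + l) (u + (e + δ′)) (c + δ)
       (+-mono-≤ u u l (e + δ′) (≤-refl u) (bound (put p j r) B B₀≤B))
     (≤-trans (u + (e + δ′)) (e + (u + δ′)) (c + δ)
       (≐⇒≤ (u + (e + δ′)) (e + (u + δ′)) λ n → exchange (seq u n) (seq e n) (seq δ′ n))
     (≤-trans (e + (u + δ′)) (e + (δ + m)) (c + δ)
       (+-mono-≤ e e (u + δ′) (δ + m) (≤-refl e) (distances-put B {x} {x′} {p} {r}
         (ℕ.m⊔n≤o⇒n≤o N (suc j) N⊔j<B) x′≈r))
     (≤-trans (e + (δ + m)) (e + (δ + d)) (c + δ)
       (+-mono-≤ e e (δ + m) (δ + d) (≤-refl e) (+-mono-≤ δ δ m d (≤-refl δ) m≤d))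
     (≤-trans (e + (δ + d)) (d + e + δ) (c + δ)
       (≐⇒≤ (e + (δ + d)) (d + e + δ) λ n → rotate (seq e n) (seq δ n) (seq d n))
       (+-mono-≤ (d + e) c δ δ d+e≤c (≤-refl δ))))))
  where
  exchange : ∀ p q r → p ℚ.+ (q ℚ.+ r) ≡ q ℚ.+ (p ℚ.+ r)
  exchange = solve-∀ ℚ-ring
  rotate : ∀ p q r → p ℚ.+ (q ℚ.+ r) ≡ r ℚ.+ p ℚ.+ q
  rotate = solve-∀ ℚ-ring

-- Every branch of the minimum comes from actual runs: prefixing the move of server `j`, of cost
-- `u`, shows that `w - u` is a lower bound for all runs on the remaining requests.
opt-greatest : ∀ σ N p w → (∀ d → Run Serves p σ d → w ≤ d) → w ≤ opt N p σ
opt-greatest []      N p w lower = lower 0ℝ (done (≐⇒≈ 0ℝ 0ℝ λ _ → refl))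
opt-greatest (r ∷ σ) N p w lower = minimum-glb N
  (λ j → ∣ pos r - pos (p j) ∣ + opt (suc N) (put p j r) σ) w λ j →
  let u = ∣ pos r - pos (p j) ∣
      o = opt (suc N) (put p j r) σ
  in ≤-trans w (u + (w - u)) (u + o)
       (≐⇒≤ w (u + (w - u)) λ n → Estimates.add-sub (seq w n) (seq u n))
       (+-mono-≤ u u (w - u) o (≤-refl u) (opt-greatest σ (suc N) (put p j r) (w - u) λ e run →
         ≤-trans (w - u) (u + e - u) e
           (+-mono-≤ w (u + e) (- u) (- u) (lower (u + e)
             (serve {x = p} {x′ = put p j r} {r = r} {d = u}
               (j , ≡⇒≈ {put p j r j} {r} (put-≡ p j r)) (put-travel p j r) run
               (≐⇒≈ (u + e) (u + e) λ _ → refl)))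
             (≤-refl (- u)))
           (≐⇒≤ (u + e - u) e λ n → Estimates.add-sub′ (seq u n) (seq e n))))

opt-OPT : ∀ σ → OPT σ (opt 0 source σ)
opt-OPT σ = lower , opt-greatest σ 0 source
  where
  lower : ∀ d → Run Serves source σ d → opt 0 source σ ≤ d
  lower d run with lazyCost≤run run
  ... | js , B , bound = ≤-trans (opt 0 source σ) (lazyCost source js σ) d
    (pointwise⇒≤ (opt 0 source σ) (lazyCost source js σ)
      (opt≤lazyCost 0 source js σ λ _ _ _ → refl))
    (≤-trans (lazyCost source js σ) (d + distances B source source) d
      (bound source B ℕ.≤-refl)
      (≐⇒≤ (d + distances B source source) d λ n → trans
        (cong (seq d n ℚ.+_) (∑<-zero B {λ i → ∣ 0ℝ - 0ℝ ∣} n λ _ _ → refl))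
        (ℚ.+-identityʳ (seq d n))))

-- Joint runs of the algorithm and of an offline solution

≐-sym : ∀ {x y} → x ≐ y → y ≐ x
≐-sym x≐y n = sym (x≐y n)

infix 4 _≋_

_≋_ : Config → Config → Set
x ≋ y = ∀ j → pos (x j) ≐ pos (y j)

put-at : ∀ x i r → pos (put x i r i) ≐ pos r
put-at x i r n = cong (λ a → seq (pos a) n) (put-≡ x i r)

put-off : ∀ x i r {j} → j ≢ i → pos (put x i r j) ≐ pos (x j)
put-off x i r j≢i n = cong (λ a → seq (pos a) n) (put-≢ x i r j≢i)

-- Unlike `Run`, it records the final configuration, so that pieces can be concatenated.
-- Configurations are functions built in different ways, hence `stay` admits a change to a pointwise
-- equal one.
data Path (step : Rule) : Config → List Point → Config → ℝ → Set where
  stay : ∀ {x x′} → x ≋ x′ → Path step x [] x′ 0ℝ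
  move : ∀ {x x′ x″ r σ d e} → step x r x′ → Travel x x′ d → Path step x′ σ x″ e →
         Path step x (r ∷ σ) x″ (d + e)

path⇒run : ∀ {step x σ x′ d} → Path step x σ x′ d → Run step x σ d
path⇒run (stay _) = done (≐⇒≈ 0ℝ 0ℝ λ _ → refl)
path⇒run (move {x} {x′} {r = r} {d = d} {e} st tr p) =
  serve {x = x} {x′} {r} {d = d} {e} st tr (path⇒run p) (≐⇒≈ (d + e) (d + e) λ _ → refl)

Respectful : Rule → Set
Respectful step = ∀ {x y r y′} → x ≋ y → step y r y′ → step x r y′

∑<-cong : ∀ N {f g} → (∀ j → f j ≐ g j) → ∑< N f ≐ ∑< N g
∑<-cong zero    f≐g n = refl
∑<-cong (suc N) f≐g n = cong₂ ℚ._+_ (∑<-cong N f≐g n) (f≐g N n)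

travel-cong : ∀ {x y y′ d} → x ≋ y → Travel y y′ d → Travel x y′ d
travel-cong {x} {y} {y′} {d} x≋y (N , same , d≈∑) = N ,
  (λ j N≤j → ≈-trans (pos (y′ j)) (pos (y j)) (pos (x j)) (same j N≤j)
    (≐⇒≈ (pos (y j)) (pos (x j)) (≐-sym {pos (x j)} {pos (y j)} (x≋y j)))) ,
  ≈-trans d (distances N y′ y) (distances N y′ x) d≈∑
    (≐⇒≈ (distances N y′ y) (distances N y′ x)
      (∑<-cong N λ j n → cong (λ q → ℚ.∣ seq (pos (y′ j)) n ℚ.- q ∣) (sym (x≋y j n))))

path-cong : ∀ {step} → Respectful step → ∀ {x y σ y′ d} → x ≋ y →
  Path step y σ y′ d → Path step x σ y′ d
path-cong resp x≋y (stay y≋y′)     = stay λ j n → trans (x≋y j n) (y≋y′ j n)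
path-cong resp {x} {y} x≋y (move {x′ = x′} {d = d} st tr p) =
  move (resp x≋y st) (travel-cong {x} {y} {x′} {d} x≋y tr) p

path-++ : ∀ {step} → Respectful step → ∀ {x σ y d τ z e} →
  Path step x σ y d → Path step y τ z e → ∃[ c ] (Path step x (σ ++ τ) z c × c ≐ d + e)
path-++ resp {e = e} (stay x≋y) q = e , path-cong resp x≋y q , λ n → sym (ℚ.+-identityˡ (seq e n))
path-++ resp {e = e} (move {d = d} {d′} st tr p) q with path-++ resp p q
... | c , r , c≐ = d + c , move st tr r , λ n →
  trans (cong (seq d n ℚ.+_) (c≐ n)) (sym (ℚ.+-assoc (seq d n) (seq d′ n) (seq e n)))

serves-respectful : Respectful Serves
serves-respectful x≋y st = st

dc-respectful : ∀ {s} → Respectful (DCStep s)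
dc-respectful {s} {x} {y} {r} {y′} x≋y (outer y≤r y′≈r same) =
  outer (≤-trans (pos (x 0)) (pos (y 0)) (pos r) (≐⇒≤ (pos (x 0)) (pos (y 0)) (x≋y 0)) y≤r) y′≈r
    λ j j≢0 → ≈-trans (pos (y′ j)) (pos (y j)) (pos (x j)) (same j j≢0)
      (≐⇒≈ (pos (y j)) (pos (x j)) λ n → sym (x≋y j n))
dc-respectful {s} {x} {y} {r} {y′} x≋y (inner i t l≤r r≤u 0≤t left right l′≤r r≤u′ hit same) =
  inner i t
    (≤-trans (pos (x (suc i))) (pos (y (suc i))) (pos r)
      (≐⇒≤ (pos (x (suc i))) (pos (y (suc i))) (x≋y (suc i))) l≤r)
    (≤-trans (pos r) (pos (y i)) (pos (x i)) r≤u
      (≐⇒≤ (pos (y i)) (pos (x i)) λ n → sym (x≋y i n)))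
    0≤t
    (≈-trans (pos (y′ (suc i))) (pos (y (suc i)) + s i * t) (pos (x (suc i)) + s i * t) left
      (≐⇒≈ (pos (y (suc i)) + s i * t) (pos (x (suc i)) + s i * t)
        λ n → cong (ℚ._+ seq (s i * t) n) (sym (x≋y (suc i) n))))
    (≈-trans (pos (y′ i)) (pos (y i) - t) (pos (x i) - t) right
      (≐⇒≈ (pos (y i) - t) (pos (x i) - t) λ n → cong (ℚ._- seq t n) (sym (x≋y i n))))
    l′≤r r≤u′ hit
    λ j j≢i j≢1+i → ≈-trans (pos (y′ j)) (pos (y j)) (pos (x j)) (same j j≢i j≢1+i)
      (≐⇒≈ (pos (y j)) (pos (x j)) λ n → sym (x≋y j n))

covered-travel : ∀ z → Travel z z 0ℝ
covered-travel z = 0 , (λ j _ → ≐⇒≈ (pos (z j)) (pos (z j)) λ _ → refl) , ≐⇒≈ 0ℝ 0ℝ λ _ → refl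

∑<-≤ι : ∀ N {f n} → (∀ j → j ℕ.< N → seq (f j) n ℚ.≤ 1ℚ) → seq (∑< N f) n ℚ.≤ ι N
∑<-≤ι zero    f≤1 = ℚ.≤-refl
∑<-≤ι (suc N) f≤1 = ℚ.≤-trans
  (ℚ.+-mono-≤ (∑<-≤ι N λ j j<N → f≤1 j (ℕ.m≤n⇒m≤1+n j<N)) (f≤1 N ℕ.≤-refl))
  (ℚ.≤-reflexive (ℚ.+-comm (ι N) 1ℚ))

place : ∀ Q → (∀ n → 0ℚ ℚ.≤ seq Q n) → ℕ → Point
place Q 0≤Q k = mkPoint (Q + const (ι k))
  (pointwise⇒≤ 0ℝ (Q + const (ι k)) λ n → 0≤p+q (0≤Q n) (0≤ι k))

-- The numerical contradiction

abstract
  -- Since 2τ = H(1 + H) and q ≥ 2τ, the online bound satisfies 4τ(q - τ) ≥ 2τq ≥ H·Hq. The offline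
  -- bound is at most 7Hq, because H ≤ q. As Hq ≥ 1, the negated inequality would give H·Hq ≤ (32r +
  -- 4κ + 4)Hq, but H exceeds this factor by 1.
  overflow : ∀ {τ H q r κ} → 0ℚ ℚ.≤ τ → 0ℚ ℚ.≤ r → 0ℚ ℚ.≤ κ →
    H ≡ ι 5 ℚ.+ (ι 32 ℚ.* r ℚ.+ ι 4 ℚ.* κ) → τ ℚ.+ τ ≡ H ℚ.* (1ℚ ℚ.+ H ℚ.+ (0ℚ ℚ.+ 0ℚ)) →
    τ ℚ.+ τ ℚ.≤ q →
    ¬ τ ℚ.* (q ℚ.- τ) ℚ.≤
      r ℚ.* (H ℚ.* (q ℚ.+ H ℚ.+ (q ℚ.+ H ℚ.+ (q ℚ.+ H))) ℚ.+ H ℚ.* (q ℚ.- τ) ℚ.+ 1ℚ) ℚ.+ κ ℚ.+ 1ℚ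
  overflow {τ} {H} {q} {r} {κ} 0≤τ 0≤r 0≤κ H≡ 2τ≡ 2τ≤q A≤ = ℚ.<-irrefl refl (ℚ.≤-<-trans (begin
    0ℚ
      ≤⟨ 0≤p+q (0≤q-p chain) (0≤p*q (0≤q-p 1≤Hq) (0≤p+q (0≤ι 5) (0≤p*q (0≤ι 4) (0≤p+q 0≤r 0≤κ)))) ⟩
    (ι 4 ℚ.* (r ℚ.* (ι 7 ℚ.* (H ℚ.* q) ℚ.+ 1ℚ) ℚ.+ κ ℚ.+ 1ℚ) ℚ.- H ℚ.* (H ℚ.* q)) ℚ.+
      (H ℚ.* q ℚ.- 1ℚ) ℚ.* (ι 5 ℚ.+ ι 4 ℚ.* (r ℚ.+ κ))
      ≡⟨ cong (λ p → (ι 4 ℚ.* (r ℚ.* (ι 7 ℚ.* (H ℚ.* q) ℚ.+ 1ℚ) ℚ.+ κ ℚ.+ 1ℚ) ℚ.- p ℚ.* (H ℚ.* q)) ℚ.+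
           (H ℚ.* q ℚ.- 1ℚ) ℚ.* (ι 5 ℚ.+ ι 4 ℚ.* (r ℚ.+ κ))) H≡ ⟩
    (ι 4 ℚ.* (r ℚ.* (ι 7 ℚ.* (H ℚ.* q) ℚ.+ 1ℚ) ℚ.+ κ ℚ.+ 1ℚ) ℚ.-
      (ι 5 ℚ.+ (ι 32 ℚ.* r ℚ.+ ι 4 ℚ.* κ)) ℚ.* (H ℚ.* q)) ℚ.+
      (H ℚ.* q ℚ.- 1ℚ) ℚ.* (ι 5 ℚ.+ ι 4 ℚ.* (r ℚ.+ κ))
      ≡⟨ total r κ (H ℚ.* q) ⟩
    ℚ.- 1ℚ
      ∎) (ℚ.negative⁻¹ (ℚ.- 1ℚ)))
    where
    open ℚ.≤-Reasoning

    -- The coefficient of `x - 1` is chosen such that everything except the constant -1 cancels.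
    total : ∀ r κ x →
      (ι 4 ℚ.* (r ℚ.* (ι 7 ℚ.* x ℚ.+ 1ℚ) ℚ.+ κ ℚ.+ 1ℚ) ℚ.- (ι 5 ℚ.+ (ι 32 ℚ.* r ℚ.+ ι 4 ℚ.* κ)) ℚ.* x) ℚ.+
        (x ℚ.- 1ℚ) ℚ.* (ι 5 ℚ.+ ι 4 ℚ.* (r ℚ.+ κ)) ≡ ℚ.- 1ℚ
    total = solve-∀ ℚ-ring

    1≤H : 1ℚ ℚ.≤ H
    1≤H = subst (1ℚ ℚ.≤_) (sym H≡) (ℚ.≤-trans (1≤ι 4)
      (p≤p+q (0≤p+q (0≤p*q (0≤ι 32) 0≤r) (0≤p*q (0≤ι 4) 0≤κ))))

    0≤H : 0ℚ ℚ.≤ H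
    0≤H = ℚ.≤-trans 0≤1 1≤H

    H≤q : H ℚ.≤ q
    H≤q = ≤-by (q ℚ.- (τ ℚ.+ τ) ℚ.+ H ℚ.* H) (0≤p+q (0≤q-p 2τ≤q) (0≤p*q 0≤H 0≤H))
      (trans (add q (τ ℚ.+ τ)) (trans (cong (q ℚ.- (τ ℚ.+ τ) ℚ.+_) 2τ≡) (expand (q ℚ.- (τ ℚ.+ τ)) H)))
      where
      add : ∀ p t → p ≡ p ℚ.- t ℚ.+ t
      add = solve-∀ ℚ-ring
      expand : ∀ p h → p ℚ.+ h ℚ.* (1ℚ ℚ.+ h ℚ.+ (0ℚ ℚ.+ 0ℚ)) ≡ h ℚ.+ (p ℚ.+ h ℚ.* h)
      expand = solve-∀ ℚ-ring

    0≤q : 0ℚ ℚ.≤ q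
    0≤q = ℚ.≤-trans 0≤H H≤q

    1≤Hq : 1ℚ ℚ.≤ H ℚ.* q
    1≤Hq = ℚ.≤-trans (ℚ.≤-trans 1≤H H≤q)
      (ℚ.≤-trans (ℚ.≤-reflexive (sym (ℚ.*-identityˡ q))) (*-monoʳ q 0≤q 1≤H))

    HHq≤ : H ℚ.* (H ℚ.* q) ℚ.≤ ι 4 ℚ.* (τ ℚ.* (q ℚ.- τ))
    HHq≤ = ≤-by ((τ ℚ.+ τ) ℚ.* (q ℚ.- (τ ℚ.+ τ)) ℚ.+ H ℚ.* q)
      (0≤p+q (0≤p*q (0≤p+q 0≤τ 0≤τ) (0≤q-p 2τ≤q)) (0≤p*q 0≤H 0≤q))
      (trans (double τ q) (trans (cong (λ p → (τ ℚ.+ τ) ℚ.* (q ℚ.- (τ ℚ.+ τ)) ℚ.+ p ℚ.* q) 2τ≡)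
        (expand ((τ ℚ.+ τ) ℚ.* (q ℚ.- (τ ℚ.+ τ))) H q)))
      where
      double : ∀ τ q → ι 4 ℚ.* (τ ℚ.* (q ℚ.- τ)) ≡ (τ ℚ.+ τ) ℚ.* (q ℚ.- (τ ℚ.+ τ)) ℚ.+ (τ ℚ.+ τ) ℚ.* q
      double = solve-∀ ℚ-ring
      expand : ∀ p h q → p ℚ.+ h ℚ.* (1ℚ ℚ.+ h ℚ.+ (0ℚ ℚ.+ 0ℚ)) ℚ.* q ≡ h ℚ.* (h ℚ.* q) ℚ.+ (p ℚ.+ h ℚ.* q)
      expand = solve-∀ ℚ-ring

    B≤7Hq : H ℚ.* (q ℚ.+ H ℚ.+ (q ℚ.+ H ℚ.+ (q ℚ.+ H))) ℚ.+ H ℚ.* (q ℚ.- τ) ℚ.≤ ι 7 ℚ.* (H ℚ.* q)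
    B≤7Hq = ≤-by (ι 3 ℚ.* (H ℚ.* (q ℚ.- H)) ℚ.+ H ℚ.* τ)
      (0≤p+q (0≤p*q (0≤ι 3) (0≤p*q 0≤H (0≤q-p H≤q))) (0≤p*q 0≤H 0≤τ)) (expand H q τ)
      where
      expand : ∀ h q τ → ι 7 ℚ.* (h ℚ.* q) ≡
        h ℚ.* (q ℚ.+ h ℚ.+ (q ℚ.+ h ℚ.+ (q ℚ.+ h))) ℚ.+ h ℚ.* (q ℚ.- τ) ℚ.+
          (ι 3 ℚ.* (h ℚ.* (q ℚ.- h)) ℚ.+ h ℚ.* τ)
      expand = solve-∀ ℚ-ring

    chain : H ℚ.* (H ℚ.* q) ℚ.≤ ι 4 ℚ.* (r ℚ.* (ι 7 ℚ.* (H ℚ.* q) ℚ.+ 1ℚ) ℚ.+ κ ℚ.+ 1ℚ)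
    chain = ℚ.≤-trans HHq≤ (*-monoˡ (ι 4) (0≤ι 4) (ℚ.≤-trans A≤
      (ℚ.+-monoˡ-≤ 1ℚ (ℚ.+-monoˡ-≤ κ (*-monoˡ r 0≤r (ℚ.+-monoˡ-≤ 1ℚ B≤7Hq))))))

-- Elementary moves of the adversary

module Adversary (s : ℕ → ℝ) (1≤s : ∀ i → 1ℝ ≤ s i) where

  abstract
    -- Replacing s i by max(1, s i) makes every term of the Cauchy sequence at least 1.
    S : ℕ → ℝ
    S i = max1 (s i)

    1≤S : ∀ i n → 1ℚ ℚ.≤ seq (S i) n
    1≤S i = 1≤max1 (s i)

    S≈s : ∀ i → S i ≈ s i
    S≈s i = max1≈ (s i) (1≤s i)

  0≤S : ∀ i n → 0ℚ ℚ.≤ seq (S i) n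
  0≤S i n = ℚ.≤-trans 0≤1 (1≤S i n)

  -- Algorithm and offline player serve the same requests. The bounds `A` and `B` are rational at
  -- every index, so plays are added and weakened without any reasoning about reals.
  record Play (x z x′ z′ : Config) (A B : ℕ → ℚ) : Set where
    constructor played
    field
      {requests}    : List Point
      {algCost}     : ℝ
      {offlineCost} : ℝ
      algPath       : Path (DCStep s) x requests x′ algCost
      offlinePath   : Path Serves z requests z′ offlineCost
      lower         : ∀ n → A n ℚ.≤ seq algCost n
      upper         : ∀ n → seq offlineCost n ℚ.≤ B n

  play-stay : ∀ {x z x′ z′} → x ≋ x′ → z ≋ z′ → Play x z x′ z′ (λ _ → 0ℚ) (λ _ → 0ℚ)
  play-stay x≋x′ z≋z′ = played (stay x≋x′) (stay z≋z′) (λ _ → ℚ.≤-refl) (λ _ → ℚ.≤-refl)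

  play-step : ∀ {x z x′ z′} r {a b} → DCStep s x r x′ → Travel x x′ a →
    ∃[ k ] pos (z′ k) ≐ pos r → Travel z z′ b → Play x z x′ z′ (seq a) (seq b)
  play-step {x} {z} {x′} {z′} r {a} {b} st tr (k , z′≐r) tr′ = played
    (move {x = x} {x′} {x′} {r} {d = a} st tr (stay λ _ _ → refl))
    (move {x = z} {z′} {z′} {r} {d = b} (k , ≐⇒≈ (pos (z′ k)) (pos r) z′≐r) tr′ (stay λ _ _ → refl))
    (λ n → ℚ.≤-reflexive (sym (ℚ.+-identityʳ (seq a n))))
    (λ n → ℚ.≤-reflexive (ℚ.+-identityʳ (seq b n)))

  play-trans : ∀ {x z x′ z′ x″ z″ A B A′ B′} → Play x z x′ z′ A B → Play x′ z′ x″ z″ A′ B′ →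
    Play x z x″ z″ (λ n → A n ℚ.+ A′ n) (λ n → B n ℚ.+ B′ n)
  play-trans {A = A} {B} {A′} {B′} (played p q A≤a b≤B) (played p′ q′ A′≤a′ b′≤B′)
    with path-++ dc-respectful p p′ | path-++ (λ {x} {y} {r} {y′} → serves-respectful {x} {y} {r} {y′}) q q′
  ... | c , p″ , c≐ | e , q″ , e≐ = played p″ q″
    (λ n → subst (A n ℚ.+ A′ n ℚ.≤_) (sym (c≐ n)) (ℚ.+-mono-≤ (A≤a n) (A′≤a′ n)))
    (λ n → subst (ℚ._≤ B n ℚ.+ B′ n) (sym (e≐ n)) (ℚ.+-mono-≤ (b≤B n) (b′≤B′ n)))

  play-weaken : ∀ {x z x′ z′ A B A′ B′} → (∀ n → A′ n ℚ.≤ A n) → (∀ n → B n ℚ.≤ B′ n) →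
    Play x z x′ z′ A B → Play x z x′ z′ A′ B′
  play-weaken A′≤A B≤B′ (played p q A≤a b≤B) =
    played p q (λ n → ℚ.≤-trans (A′≤A n) (A≤a n)) (λ n → ℚ.≤-trans (b≤B n) (B≤B′ n))

  -- The algorithm is credited with cost 0 only: such moves occur solely during the deployment,
  -- where no lower bound is wanted.
  play-outer : ∀ {x z} r k → (∀ n → seq (pos (x 0)) n ℚ.≤ seq (pos r) n) →
    Play x z (put x 0 r) (put z k r) (λ _ → 0ℚ) (λ n → seq ∣ pos r - pos (z k) ∣ n)
  play-outer {x} {z} r k x≤r = play-weaken
    (λ n → ℚ.0≤∣p∣ (seq (pos r - pos (x 0)) n)) (λ _ → ℚ.≤-refl)
    (play-step {x} {z} {put x 0 r} {put z k r} r {∣ pos r - pos (x 0) ∣} {∣ pos r - pos (z k) ∣}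
      (outer (pointwise⇒≤ (pos (x 0)) (pos r) x≤r)
        (≡⇒≈ {put x 0 r 0} {r} (put-≡ x 0 r))
        (λ j j≢0 → ≡⇒≈ {put x 0 r j} {x j} (put-≢ x 0 r j≢0)))
      (put-travel x 0 r) (k , put-at z k r) (put-travel z k r))

  -- The passage from the true speed `s i` to `S i` takes place here: the rule asks for the left
  -- position only up to `≈`, while all bookkeeping uses `S i`.
  play-inner : ∀ {x x′ z z′ b} i r t →
    (∀ n → 0ℚ ℚ.≤ seq t n) →
    pos (x′ (suc i)) ≐ pos (x (suc i)) + S i * t →
    pos (x′ i) ≐ pos (x i) - t →
    (∀ j → j ≢ i → j ≢ suc i → pos (x′ j) ≐ pos (x j)) →
    (∀ n → seq (pos (x′ (suc i))) n ℚ.≤ seq (pos r) n) →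
    (∀ n → seq (pos r) n ℚ.≤ seq (pos (x′ i)) n) →
    pos (x′ (suc i)) ≐ pos r ⊎ pos (x′ i) ≐ pos r →
    ∃[ k ] pos (z′ k) ≐ pos r → Travel z z′ b →
    Play x z x′ z′ (λ n → seq t n ℚ.+ seq (S i) n ℚ.* seq t n) (seq b)
  play-inner {x} {x′} {z} {z′} {b} i r t 0≤t left right same l≤r r≤u hit cov tr = play-weaken
    cost (λ _ → ℚ.≤-refl)
    (play-step {x} {z} {x′} {z′} r {distances (suc (suc i)) x′ x} {b}
      (inner i t
        (pointwise⇒≤ (pos (x (suc i))) (pos r) λ n → ℚ.≤-trans (p≤p+q (0≤St n))
          (ℚ.≤-trans (ℚ.≤-reflexive (sym (left n))) (l≤r n)))
        (pointwise⇒≤ (pos r) (pos (x i)) λ n → ℚ.≤-trans (r≤u n)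
          (ℚ.≤-trans (ℚ.≤-reflexive (right n)) (≤-by (seq t n) (0≤t n) (retract (seq (pos (x i)) n) (seq t n)))))
        (pointwise⇒≤ 0ℝ t 0≤t)
        (≈-trans (pos (x′ (suc i))) (pos (x (suc i)) + S i * t) (pos (x (suc i)) + s i * t)
          (≐⇒≈ (pos (x′ (suc i))) (pos (x (suc i)) + S i * t) left) speed)
        (≐⇒≈ (pos (x′ i)) (pos (x i) - t) right)
        (pointwise⇒≤ (pos (x′ (suc i))) (pos r) l≤r)
        (pointwise⇒≤ (pos r) (pos (x′ i)) r≤u)
        (reached hit)
        (λ j j≢i j≢1+i → ≐⇒≈ (pos (x′ j)) (pos (x j)) (same j j≢i j≢1+i)))
      (suc (suc i) ,
        (λ j 2+i≤j → ≐⇒≈ (pos (x′ j)) (pos (x j))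
          (same j (λ j≡i → ℕ.<-irrefl (sym j≡i) (ℕ.<-trans (ℕ.n<1+n i) 2+i≤j))
                  (λ j≡1+i → ℕ.<-irrefl (sym j≡1+i) 2+i≤j))) ,
        ≐⇒≈ (distances (suc (suc i)) x′ x) (distances (suc (suc i)) x′ x) λ _ → refl)
      cov tr)
    where
    0≤St : ∀ n → 0ℚ ℚ.≤ seq (S i) n ℚ.* seq t n
    0≤St n = 0≤p*q (0≤S i n) (0≤t n)

    retract : ∀ p q → p ≡ p ℚ.- q ℚ.+ q
    retract = solve-∀ ℚ-ring

    speed : pos (x (suc i)) + S i * t ≈ pos (x (suc i)) + s i * t
    speed = +-mono-≤ p p (S i * t) (s i * t) (≤-refl p) (*-monoˡ-≤ (S i) (s i) t 0≤t (proj₁ (S≈s i))) ,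
            +-mono-≤ p p (s i * t) (S i * t) (≤-refl p) (*-monoˡ-≤ (s i) (S i) t 0≤t (proj₂ (S≈s i)))
      where
      p : ℝ
      p = pos (x (suc i))

    reached : pos (x′ (suc i)) ≐ pos r ⊎ pos (x′ i) ≐ pos r → pos (x′ (suc i)) ≈ pos r ⊎ pos (x′ i) ≈ pos r
    reached (inj₁ eq) = inj₁ (≐⇒≈ (pos (x′ (suc i))) (pos r) eq)
    reached (inj₂ eq) = inj₂ (≐⇒≈ (pos (x′ i)) (pos r) eq)

    cost : ∀ n → seq t n ℚ.+ seq (S i) n ℚ.* seq t n ℚ.≤ seq (distances (suc (suc i)) x′ x) n
    cost n = ℚ.+-mono-≤
      (ℚ.≤-trans (ℚ.≤-reflexive (sym (unshift (seq (pos (x i)) n) (seq t n))))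
        (ℚ.≤-trans (subst (λ q → ℚ.- (seq (pos (x i)) n ℚ.- seq t n ℚ.- seq (pos (x i)) n)
            ℚ.≤ ℚ.∣ q ℚ.- seq (pos (x i)) n ∣)
            (sym (right n)) (-p≤∣p∣ (seq (pos (x i)) n ℚ.- seq t n ℚ.- seq (pos (x i)) n)))
          (p≤q+p (0≤∑< i {λ j → ∣ pos (x′ j) - pos (x j) ∣}
            λ j → ℚ.0≤∣p∣ (seq (pos (x′ j) - pos (x j)) n)))))
      (ℚ.≤-trans (ℚ.≤-reflexive (sym (Estimates.add-sub′ (seq (pos (x (suc i))) n) (seq (S i * t) n))))
        (subst (λ q → seq (pos (x (suc i)) + S i * t - pos (x (suc i))) n ℚ.≤ ℚ.∣ q ℚ.- seq (pos (x (suc i))) n ∣)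
          (sym (left n)) (p≤∣p∣ (seq (pos (x (suc i)) + S i * t - pos (x (suc i))) n))))
      where
      unshift : ∀ p q → ℚ.- (p ℚ.- q ℚ.- p) ≡ q
      unshift = solve-∀ ℚ-ring

  -- How far server suc (d + i) moves per unit that server i moves to the left, when the
  -- servers in between are called back to their places.
  W : ℕ → ℕ → ℝ
  W zero    i = S i
  W (suc d) i = S i * W d (suc i)

  abstract
    1≤W : ∀ d i n → 1ℚ ℚ.≤ seq (W d i) n
    1≤W zero    i n = 1≤S i n
    1≤W (suc d) i n = ℚ.≤-trans (1≤S i n) (ℚ.≤-trans
      (ℚ.≤-reflexive (sym (ℚ.*-identityʳ (seq (S i) n))))
      (*-monoˡ (seq (S i) n) (0≤S i n) (1≤W d (suc i) n)))

    0≤W : ∀ d i n → 0ℚ ℚ.≤ seq (W d i) n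
    0≤W d i n = ℚ.≤-trans 0≤1 (1≤W d i n)

    S≤W : ∀ d i n → seq (S i) n ℚ.≤ seq (W d i) n
    S≤W zero    i n = ℚ.≤-refl
    S≤W (suc d) i n = ℚ.≤-trans (ℚ.≤-reflexive (sym (ℚ.*-identityʳ (seq (S i) n))))
      (*-monoˡ (seq (S i) n) (0≤S i n) (1≤W d (suc i) n))

  -- Cascades

  -- The net effect of one or several complete cascades; servers that are displaced and called back
  -- on the way do not show.
  record Pull (d i m : ℕ) (a : ℝ) (y Y : Config) : Set where
    field
      top  : pos (y i) ≐ pos (Y i) + a
      far  : pos (Y m) ≐ pos (y m) + W d i * a
      rest : ∀ j → j ≢ i → j ≢ m → pos (y j) ≐ pos (Y j)

  open Pull

  Spaced : ℕ → ℕ → Config → Set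
  Spaced i m y = ∀ j → i ℕ.≤ j → j ℕ.< m → ∀ n → seq (pos (y (suc j))) n ℚ.+ 1ℚ ℚ.≤ seq (pos (y j)) n

  +1≤⇒≤ : ∀ {p q} → p ℚ.+ 1ℚ ℚ.≤ q → p ℚ.≤ q
  +1≤⇒≤ = ℚ.≤-trans (p≤p+q 0≤1)

  shifted : ∀ (p t : ℝ) → 0ℝ ≤ p → (∀ n → 0ℚ ℚ.≤ seq t n) → Point
  shifted p t 0≤p 0≤t = mkPoint (p + t) (≤-trans 0ℝ (0ℝ + 0ℝ) (p + t)
    (≐⇒≤ 0ℝ (0ℝ + 0ℝ) λ _ → refl) (+-mono-≤ 0ℝ p 0ℝ t 0≤p (pointwise⇒≤ 0ℝ t 0≤t)))

  -- Calling server `i` to its new place displaces server `suc i` to the right by `S i * a`, and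
  -- calling that one back is the same problem for `suc i` and `S i * a`. No displacement exceeds
  -- `W d i * a`, hence none exceeds the unit gap to the right neighbour. The offline player pays
  -- for the first request only, since `Z` covers the later ones.
  cascade : ∀ d i m → m ≡ suc (d ℕ.+ i) → ∀ a {y Y z Z b} → (∀ n → 0ℚ ℚ.≤ seq a n) →
    (∀ n → seq (W d i * a) n ℚ.≤ 1ℚ) → Pull d i m a y Y → Spaced i m Y →
    (∀ j → i ℕ.≤ j → j ℕ.< m → ∃[ k ] pos (Z k) ≐ pos (Y j)) → Travel z Z b →
    Play y z Y Z (λ n → ι (suc d) ℚ.* seq a n ℚ.+ seq (W d i * a) n) (seq b)
  cascade zero i _ refl a {y} {Y} {z} {Z} {b} 0≤a Wa≤1 pull spaced cov tr =
    play-weaken (λ n → ℚ.≤-reflexive (count (seq a n) (seq (S i * a) n))) (λ _ → ℚ.≤-refl)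
      (play-inner {y} {Y} {z} {Z} {b} i (Y i) a 0≤a (far pull)
        (λ n → trans (sym (p+q-q≡p (seq (pos (Y i)) n) (seq a n))) (cong (ℚ._- seq a n) (sym (top pull n))))
        (λ j j≢i j≢1+i n → sym (rest pull j j≢i j≢1+i n))
        (λ n → +1≤⇒≤ (spaced i ℕ.≤-refl ℕ.≤-refl n))
        (λ _ → ℚ.≤-refl) (inj₂ λ _ → refl) (cov i ℕ.≤-refl ℕ.≤-refl) tr)
    where
    count : ∀ p q → (1ℚ ℚ.+ 0ℚ) ℚ.* p ℚ.+ q ≡ p ℚ.+ q
    count = solve-∀ ℚ-ring
  cascade (suc d) i m refl a {y} {Y} {z} {Z} {b} 0≤a Wa≤1 pull spaced cov tr =
    play-weaken cost (λ n → ℚ.≤-reflexive (ℚ.+-identityʳ (seq b n)))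
      (play-trans
        (play-inner {y} {y₁} {z} {Z} {b} i (Y i) a 0≤a
          (put-at x₁ (suc i) r)
          (λ n → trans (y₁-i n) (trans (sym (p+q-q≡p (seq (pos (Y i)) n) (seq a n)))
            (cong (ℚ._- seq a n) (sym (top pull n)))))
          (λ j j≢i j≢1+i n → trans (put-off x₁ (suc i) r j≢1+i n) (put-off y i (Y i) j≢i n))
          left≤
          (λ n → ℚ.≤-reflexive (sym (y₁-i n))) (inj₂ y₁-i) (cov i ℕ.≤-refl i<m) tr)
        (cascade d (suc i) m (cong suc (sym (ℕ.+-suc d i))) (S i * a) {y₁} {Y} {Z} {Z} {0ℝ}
          0≤Sa
          (λ n → ℚ.≤-trans (ℚ.≤-reflexive (assoc (seq (W d (suc i)) n) (seq (S i) n) (seq a n))) (Wa≤1 n))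
          pull₁ (λ j 1+i≤j → spaced j (ℕ.<⇒≤ 1+i≤j)) (λ j 1+i≤j → cov j (ℕ.<⇒≤ 1+i≤j)) (covered-travel Z)))
    where
    i<m : i ℕ.< suc (suc d ℕ.+ i)
    i<m = ℕ.s≤s (ℕ.m≤n+m i (suc d))
    1+i<m : suc i ℕ.< suc (suc d ℕ.+ i)
    1+i<m = ℕ.s≤s (ℕ.s≤s (ℕ.m≤n+m i d))
    1+i≢i : suc i ≢ i
    1+i≢i = ℕ.1+n≢n

    0≤Sa : ∀ n → 0ℚ ℚ.≤ seq (S i * a) n
    0≤Sa n = 0≤p*q (0≤S i n) (0≤a n)

    r : Point
    r = shifted (pos (y (suc i))) (S i * a) (nonNeg (y (suc i))) 0≤Sa

    x₁ y₁ : Config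
    x₁ = put y i (Y i)
    y₁ = put x₁ (suc i) r

    y₁-i : pos (y₁ i) ≐ pos (Y i)
    y₁-i n = trans (put-off x₁ (suc i) r (λ i≡1+i → 1+i≢i (sym i≡1+i)) n) (put-at y i (Y i) n)

    next : pos (y (suc i)) ≐ pos (Y (suc i))
    next = rest pull (suc i) 1+i≢i (λ 1+i≡m → ℕ.<-irrefl 1+i≡m 1+i<m)

    assoc : ∀ p q r → p ℚ.* (q ℚ.* r) ≡ q ℚ.* p ℚ.* r
    assoc = solve-∀ ℚ-ring

    left≤ : ∀ n → seq (pos (y₁ (suc i))) n ℚ.≤ seq (pos (Y i)) n
    left≤ n = ℚ.≤-trans (ℚ.≤-reflexive (put-at x₁ (suc i) r n)) (ℚ.≤-trans
      (ℚ.+-mono-≤ (ℚ.≤-reflexive (next n)) (ℚ.≤-trans (*-monoʳ (seq a n) (0≤a n) (S≤W (suc d) i n)) (Wa≤1 n)))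
      (spaced i ℕ.≤-refl i<m n))

    pull₁ : Pull d (suc i) m (S i * a) y₁ Y
    pull₁ .top n = trans (put-at x₁ (suc i) r n) (cong (ℚ._+ seq (S i * a) n) (next n))
    pull₁ .far n = trans (far pull n) (cong₂ ℚ._+_
      (sym (trans (put-off x₁ (suc i) r (λ m≡1+i → ℕ.<-irrefl (sym m≡1+i) 1+i<m) n)
                  (put-off y i (Y i) (λ m≡i → ℕ.<-irrefl (sym m≡i) i<m) n)))
      (sym (assoc (seq (W d (suc i)) n) (seq (S i) n) (seq a n))))
    pull₁ .rest j j≢1+i j≢m n with j ℕ.≟ i
    ... | yes refl = y₁-i n
    ... | no j≢i   = trans (put-off x₁ (suc i) r j≢1+i n)
      (trans (put-off y i (Y i) j≢i n) (rest pull j j≢i j≢m n))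

    cost : ∀ n → ι (suc (suc d)) ℚ.* seq a n ℚ.+ seq (W (suc d) i * a) n ℚ.≤
      seq a n ℚ.+ seq (S i) n ℚ.* seq a n ℚ.+
        (ι (suc d) ℚ.* seq (S i * a) n ℚ.+ seq (W d (suc i) * (S i * a)) n)
    -- The slack is the displacement of server `suc i` to the right, plus the excess of `S i * a`
    -- over `a` in each of the `suc d` later calls.
    cost n = ≤-by (seq (S i) n ℚ.* seq a n ℚ.+ ι (suc d) ℚ.* ((seq (S i) n ℚ.- 1ℚ) ℚ.* seq a n))
      (0≤p+q (0≤Sa n) (0≤p*q (0≤ι (suc d)) (0≤p*q (0≤q-p (1≤S i n)) (0≤a n))))
      (balance (ι (suc d)) (seq a n) (seq (S i) n) (seq (W d (suc i)) n))
      where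
      balance : ∀ k a s w → a ℚ.+ s ℚ.* a ℚ.+ (k ℚ.* (s ℚ.* a) ℚ.+ w ℚ.* (s ℚ.* a)) ≡
        (1ℚ ℚ.+ k) ℚ.* a ℚ.+ s ℚ.* w ℚ.* a ℚ.+ (s ℚ.* a ℚ.+ k ℚ.* ((s ℚ.- 1ℚ) ℚ.* a))
      balance = solve-∀ ℚ-ring

  repeat : ∀ K d i m → m ≡ suc (d ℕ.+ i) → ∀ a {y Y z Z} k → (∀ n → 0ℚ ℚ.≤ seq a n) →
    (∀ n → seq (W d i * a) n ℚ.≤ 1ℚ) → Pull d i m (const (ι K) * a) y Y → Spaced i m Y →
    pos (z k) ≐ pos (y i) → pos (Z k) ≐ pos (Y i) → (∀ l → l ≢ k → pos (z l) ≐ pos (Z l)) →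
    (∀ j → i ℕ.< j → j ℕ.< m → ∃[ l ] (l ≢ k × pos (Z l) ≐ pos (Y j))) →
    Play y z Y Z (λ n → ι (suc d) ℚ.* (ι K ℚ.* seq a n) ℚ.+ seq (W d i) n ℚ.* (ι K ℚ.* seq a n))
                 (λ n → ι K ℚ.* seq a n)
  repeat zero d i m m≡ a {y} {Y} {z} {Z} k 0≤a Wa≤1 pull spaced zk Zk zl cov =
    play-weaken (λ n → ℚ.≤-reflexive (vanish (ι (suc d)) (seq (W d i) n) (seq a n)))
                (λ n → ℚ.≤-reflexive (sym (ℚ.*-zeroˡ (seq a n))))
      (play-stay {y} {z} {Y} {Z} y≋Y z≋Z)
    where
    vanish : ∀ p q r → p ℚ.* (0ℚ ℚ.* r) ℚ.+ q ℚ.* (0ℚ ℚ.* r) ≡ 0ℚ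
    vanish = solve-∀ ℚ-ring
    top≡ : ∀ p q → p ℚ.+ 0ℚ ℚ.* q ≡ p
    top≡ = solve-∀ ℚ-ring
    far≡ : ∀ p q r → p ℚ.+ q ℚ.* (0ℚ ℚ.* r) ≡ p
    far≡ = solve-∀ ℚ-ring
    y≋Y : y ≋ Y
    y≋Y j n with j ℕ.≟ i | j ℕ.≟ m
    ... | yes refl | _        = trans (top pull n) (top≡ (seq (pos (Y j)) n) (seq a n))
    ... | no _     | yes refl = sym (trans (far pull n) (far≡ (seq (pos (y j)) n) (seq (W d i) n) (seq a n)))
    ... | no j≢i   | no j≢m   = rest pull j j≢i j≢m n
    z≋Z : z ≋ Z
    z≋Z l n with l ℕ.≟ k
    ... | yes refl = trans (zk n) (trans (y≋Y i n) (sym (Zk n)))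
    ... | no l≢k   = zl l l≢k n
  repeat (suc K) d i m refl a {y} {Y} {z} {Z} k 0≤a Wa≤1 pull spaced zk Zk zl cov =
    play-weaken
      (λ n → ℚ.≤-reflexive (sum (ι (suc d)) (seq (W d i) n) (ι K) (seq a n)))
      (λ n → subst (ℚ._≤ ι (suc K) ℚ.* seq a n) (cong (ℚ._+ ι K ℚ.* seq a n) (sym (jump n)))
        (ℚ.≤-reflexive (sum′ (ι K) (seq a n))))
      (play-trans
        (cascade d i m refl a {y} {y₁} {z} {z₁} {∣ pos r - pos (z k) ∣} 0≤a Wa≤1 pull₁ spaced₁ cov₁ (put-travel z k r))
        (repeat K d i m refl a {y₁} {Y} {z₁} {Z} k 0≤a Wa≤1 pull₂ spaced
          (λ n → trans (put-at z k r n) (sym (y₁-i n))) Zk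
          (λ l l≢k n → trans (put-off z k r l≢k n) (zl l l≢k n)) cov))
    where
    i<m : i ℕ.< m
    i<m = ℕ.s≤s (ℕ.m≤n+m i d)
    i≢m : i ≢ m
    i≢m i≡m = ℕ.<-irrefl i≡m i<m

    0≤Ka : ∀ n → 0ℚ ℚ.≤ seq (const (ι K) * a) n
    0≤Ka n = 0≤p*q (0≤ι K) (0≤a n)
    0≤Wa : ∀ n → 0ℚ ℚ.≤ seq (W d i * a) n
    0≤Wa n = 0≤p*q (0≤W d i n) (0≤a n)

    r r′ : Point
    r  = shifted (pos (Y i)) (const (ι K) * a) (nonNeg (Y i)) 0≤Ka
    r′ = shifted (pos (y m)) (W d i * a) (nonNeg (y m)) 0≤Wa

    x₁ y₁ z₁ : Config
    x₁ = put y i r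
    y₁ = put x₁ m r′
    z₁ = put z k r

    y₁-i : pos (y₁ i) ≐ pos r
    y₁-i n = trans (put-off x₁ m r′ i≢m n) (put-at y i r n)

    y₁-m : pos (y₁ m) ≐ pos r′
    y₁-m = put-at x₁ m r′

    y₁-j : ∀ j → j ≢ i → j ≢ m → pos (y₁ j) ≐ pos (y j)
    y₁-j j j≢i j≢m n = trans (put-off x₁ m r′ j≢m n) (put-off y i r j≢i n)

    add : ∀ p k a → p ℚ.+ (1ℚ ℚ.+ k) ℚ.* a ≡ p ℚ.+ k ℚ.* a ℚ.+ a
    add = solve-∀ ℚ-ring
    add′ : ∀ p w k a → p ℚ.+ w ℚ.* ((1ℚ ℚ.+ k) ℚ.* a) ≡ p ℚ.+ w ℚ.* a ℚ.+ w ℚ.* (k ℚ.* a)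
    add′ = solve-∀ ℚ-ring

    pull₁ : Pull d i m a y y₁
    pull₁ .top n = trans (top pull n) (trans (add (seq (pos (Y i)) n) (ι K) (seq a n))
      (cong (ℚ._+ seq a n) (sym (y₁-i n))))
    pull₁ .far = y₁-m
    pull₁ .rest j j≢i j≢m n = sym (y₁-j j j≢i j≢m n)

    pull₂ : Pull d i m (const (ι K) * a) y₁ Y
    pull₂ .top = y₁-i
    pull₂ .far n = trans (far pull n) (trans (add′ (seq (pos (y m)) n) (seq (W d i) n) (ι K) (seq a n))
      (cong (ℚ._+ seq (W d i * (const (ι K) * a)) n) (sym (y₁-m n))))
    pull₂ .rest j j≢i j≢m n = trans (y₁-j j j≢i j≢m n) (rest pull j j≢i j≢m n)

    y₁≤Y : ∀ j → j ≢ i → ∀ n → seq (pos (y₁ j)) n ℚ.≤ seq (pos (Y j)) n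
    y₁≤Y j j≢i n with j ℕ.≟ m
    ... | yes refl = ℚ.≤-trans (p≤p+q (0≤p*q (0≤W d i n) (0≤Ka n))) (ℚ.≤-reflexive (sym (far pull₂ n)))
    ... | no j≢m   = ℚ.≤-reflexive (rest pull₂ j j≢i j≢m n)

    Y≤y₁ : ∀ j → j ≢ m → ∀ n → seq (pos (Y j)) n ℚ.≤ seq (pos (y₁ j)) n
    Y≤y₁ j j≢m n with j ℕ.≟ i
    ... | yes refl = ℚ.≤-trans (p≤p+q (0≤Ka n)) (ℚ.≤-reflexive (sym (y₁-i n)))
    ... | no j≢i   = ℚ.≤-reflexive (sym (rest pull₂ j j≢i j≢m n))

    -- In `y₁`, server `i` is not yet left of its final place and server `m` not yet right of its
    -- own, so all gaps are at least those of `Y`.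
    spaced₁ : Spaced i m y₁
    spaced₁ j i≤j j<m n = ℚ.≤-trans
      (ℚ.+-monoˡ-≤ 1ℚ (y₁≤Y (suc j) (λ 1+j≡i → ℕ.<-irrefl (sym 1+j≡i) (ℕ.s≤s i≤j)) n))
      (ℚ.≤-trans (spaced j i≤j j<m n) (Y≤y₁ j (λ j≡m → ℕ.<-irrefl j≡m j<m) n))

    cov₁ : ∀ j → i ℕ.≤ j → j ℕ.< m → ∃[ l ] pos (z₁ l) ≐ pos (y₁ j)
    cov₁ j i≤j j<m with ℕ.m≤n⇒m<n∨m≡n i≤j
    ... | inj₂ refl = k , λ n → trans (put-at z k r n) (sym (y₁-i n))
    ... | inj₁ i<j with cov j i<j j<m
    ...   | l , l≢k , Zl = l , λ n → trans (put-off z k r l≢k n) (trans (zl l l≢k n) (trans (Zl n)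
      (sym (rest pull₂ j (λ j≡i → ℕ.<-irrefl (sym j≡i) i<j) (λ j≡m → ℕ.<-irrefl j≡m j<m) n))))

    jump : ∀ n → seq ∣ pos r - pos (z k) ∣ n ≡ seq a n
    jump n = trans (cong (λ q → ℚ.∣ seq (pos r) n ℚ.- q ∣) (trans (zk n) (top pull n)))
      (trans (cong ℚ.∣_∣ (difference (seq (pos (Y i)) n) (ι K) (seq a n)))
        (trans (ℚ.∣-p∣≡∣p∣ (seq a n)) (ℚ.0≤p⇒∣p∣≡p (0≤a n))))
      where
      difference : ∀ p k a → p ℚ.+ k ℚ.* a ℚ.- (p ℚ.+ (1ℚ ℚ.+ k) ℚ.* a) ≡ ℚ.- a
      difference = solve-∀ ℚ-ring

    sum : ∀ p w k a → p ℚ.* ((1ℚ ℚ.+ k) ℚ.* a) ℚ.+ w ℚ.* ((1ℚ ℚ.+ k) ℚ.* a) ≡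
      p ℚ.* a ℚ.+ w ℚ.* a ℚ.+ (p ℚ.* (k ℚ.* a) ℚ.+ w ℚ.* (k ℚ.* a))
    sum = solve-∀ ℚ-ring
    sum′ : ∀ k a → a ℚ.+ k ℚ.* a ≡ (1ℚ ℚ.+ k) ℚ.* a
    sum′ = solve-∀ ℚ-ring

  -- Only short cascades are possible, since a displaced server must not overtake its right
  -- neighbour; the distance D is therefore covered in many equal steps.
  slide : ∀ d i m → m ≡ suc (d ℕ.+ i) → ∀ D {y Y z Z} k → (∀ n → 0ℚ ℚ.≤ seq D n) →
    Pull d i m D y Y → Spaced i m Y →
    pos (z k) ≐ pos (y i) → pos (Z k) ≐ pos (Y i) → (∀ l → l ≢ k → pos (z l) ≐ pos (Z l)) →
    (∀ j → i ℕ.< j → j ℕ.< m → ∃[ l ] (l ≢ k × pos (Z l) ≐ pos (Y j))) →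
    Play y z Y Z (λ n → ι (suc d) ℚ.* seq D n ℚ.+ seq (W d i) n ℚ.* seq D n) (seq D)
  slide d i m m≡ D {y} {Y} {z} {Z} k 0≤D pull spaced zk Zk zl cov with bounded (W d i * D)
  ... | K , WD≤K = play-weaken
    (λ n → ℚ.≤-reflexive (cong (λ q → ι (suc d) ℚ.* q ℚ.+ seq (W d i) n ℚ.* q) (sym (whole n))))
    (λ n → ℚ.≤-reflexive (whole n))
    (repeat (suc K) d i m m≡ (const K⁻¹ * D) {y} {Y} {z} {Z} k
      (λ n → 0≤p*q (0≤recip (1≤ι K)) (0≤D n)) small pull′ spaced zk Zk zl cov)
    where
    K⁻¹ : ℚ
    K⁻¹ = recip (1≤ι K)

    whole : ∀ n → ι (suc K) ℚ.* (K⁻¹ ℚ.* seq D n) ≡ seq D n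
    whole n = trans (sym (ℚ.*-assoc (ι (suc K)) K⁻¹ (seq D n)))
      (trans (cong (ℚ._* seq D n) (*-recip (1≤ι K))) (ℚ.*-identityˡ (seq D n)))

    swap-factors : ∀ p q r → p ℚ.* (q ℚ.* r) ≡ q ℚ.* (p ℚ.* r)
    swap-factors = solve-∀ ℚ-ring

    small : ∀ n → seq (W d i * (const K⁻¹ * D)) n ℚ.≤ 1ℚ
    small n = ℚ.≤-trans (ℚ.≤-reflexive (swap-factors (seq (W d i) n) K⁻¹ (seq D n)))
      (ℚ.≤-trans (*-monoˡ K⁻¹ (0≤recip (1≤ι K)) (ℚ.≤-trans (p≤∣p∣ (seq (W d i * D) n))
          (ℚ.≤-trans (WD≤K n) (p≤q+p 0≤1))))
        (ℚ.≤-reflexive (trans (ℚ.*-comm K⁻¹ (ι (suc K))) (*-recip (1≤ι K)))))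

    pull′ : Pull d i m (const (ι (suc K)) * (const K⁻¹ * D)) y Y
    pull′ .top n = trans (top pull n) (cong (seq (pos (Y i)) n ℚ.+_) (sym (whole n)))
    pull′ .far n = trans (far pull n) (cong (λ q → seq (pos (y m)) n ℚ.+ seq (W d i) n ℚ.* q) (sym (whole n)))
    pull′ .rest = rest pull

  -- A request at the position of a server does not move the algorithm (t = 0). It gives the offline
  -- player, whose servers move only when a request is served, an occasion to rearrange them.
  play-null : ∀ {y z z′ b} i → (∀ n → seq (pos (y (suc i))) n ℚ.≤ seq (pos (y i)) n) →
    ∃[ k ] pos (z′ k) ≐ pos (y (suc i)) → Travel z z′ b → Play y z y z′ (λ _ → 0ℚ) (seq b)
  play-null {y} {z} {z′} {b} i y≤y cov tr = play-weaken
    (λ n → ℚ.≤-reflexive (sym (no-cost (seq (S i) n)))) (λ _ → ℚ.≤-refl)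
    (play-inner {y} {y} {z} {z′} {b} i (y (suc i)) 0ℝ (λ _ → ℚ.≤-refl)
      (λ n → no-move (seq (pos (y (suc i))) n) (seq (S i) n))
      (λ n → no-move′ (seq (pos (y i)) n))
      (λ _ _ _ _ → refl) (λ _ → ℚ.≤-refl) y≤y (inj₁ λ _ → refl) cov tr)
    where
    no-cost : ∀ p → 0ℚ ℚ.+ p ℚ.* 0ℚ ≡ 0ℚ
    no-cost = solve-∀ ℚ-ring
    no-move : ∀ p q → p ≡ p ℚ.+ q ℚ.* 0ℚ
    no-move = solve-∀ ℚ-ring
    no-move′ : ∀ p → p ≡ p ℚ.- 0ℚ
    no-move′ = solve-∀ ℚ-ring

  -- Shifting a whole cluster

  -- The total pull on server b + e + d per unit of distance when the servers b + e - 1, ..., b move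
  -- left in this order; `d` counts the cluster servers that have moved before.
  ΣW : ℕ → ℕ → ℕ → ℝ
  ΣW zero    d b = 0ℝ
  ΣW (suc e) d b = W d (b ℕ.+ e) + ΣW e (suc d) b

  abstract
    0≤ΣW : ∀ e d b n → 0ℚ ℚ.≤ seq (ΣW e d b) n
    0≤ΣW zero    d b n = ℚ.≤-refl
    0≤ΣW (suc e) d b n = 0≤p+q (0≤W d (b ℕ.+ e) n) (0≤ΣW e (suc d) b n)

    1≤ΣW : ∀ e d b n → 1ℚ ℚ.≤ seq (ΣW (suc e) d b) n
    1≤ΣW e d b n = ℚ.≤-trans (1≤W d (b ℕ.+ e) n) (p≤p+q (0≤ΣW e (suc d) b n))

  -- The sum (d + 1) + ... + (d + e): each slide involves one server more than the preceding one.
  tri : ℕ → ℕ → ℚ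
  tri zero    d = 0ℚ
  tri (suc e) d = ι (suc d) ℚ.+ tri e (suc d)

  abstract
    0≤tri : ∀ e d → 0ℚ ℚ.≤ tri e d
    0≤tri zero    d = ℚ.≤-refl
    0≤tri (suc e) d = 0≤p+q (0≤ι (suc d)) (0≤tri e (suc d))

    tri+tri : ∀ e d → tri e d ℚ.+ tri e d ≡ ι e ℚ.* (1ℚ ℚ.+ ι e ℚ.+ (ι d ℚ.+ ι d))
    tri+tri zero    d = sym (ℚ.*-zeroˡ (1ℚ ℚ.+ 0ℚ ℚ.+ (ι d ℚ.+ ι d)))
    tri+tri (suc e) d = trans (regroup (ι (suc d)) (tri e (suc d)))
      (trans (cong (ι (suc d) ℚ.+ ι (suc d) ℚ.+_) (tri+tri e (suc d))) (expand (ι e) (ι d)))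
      where
      regroup : ∀ p q → p ℚ.+ q ℚ.+ (p ℚ.+ q) ≡ p ℚ.+ p ℚ.+ (q ℚ.+ q)
      regroup = solve-∀ ℚ-ring
      expand : ∀ e d → (1ℚ ℚ.+ d) ℚ.+ (1ℚ ℚ.+ d) ℚ.+ e ℚ.* (1ℚ ℚ.+ e ℚ.+ ((1ℚ ℚ.+ d) ℚ.+ (1ℚ ℚ.+ d))) ≡
        (1ℚ ℚ.+ e) ℚ.* (1ℚ ℚ.+ (1ℚ ℚ.+ e) ℚ.+ (d ℚ.+ d))
      expand = solve-∀ ℚ-ring

  -- The leftmost server of the cluster goes first, so that each server finds its left neighbour
  -- already in the final place and the spacing required by `slide` holds. Offline server `e`
  -- accompanies the algorithm's server `b + e`.
  shift : ∀ e d b m → m ≡ b ℕ.+ (e ℕ.+ d) → ∀ D {y Y z Z} → (∀ n → 0ℚ ℚ.≤ seq D n) →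
    (∀ k → k ℕ.< e → pos (y (b ℕ.+ k)) ≐ pos (Y (b ℕ.+ k)) + D) →
    pos (Y m) ≐ pos (y m) + ΣW e d b * D →
    (∀ j → (∀ k → k ℕ.< e → j ≢ b ℕ.+ k) → j ≢ m → pos (y j) ≐ pos (Y j)) →
    Spaced b m Y →
    (∀ k → k ℕ.< e → pos (z k) ≐ pos (y (b ℕ.+ k))) →
    (∀ k → e ℕ.≤ k → pos (z k) ≐ pos (Z k)) →
    (∀ k → k ℕ.< e ℕ.+ d → pos (Z k) ≐ pos (Y (b ℕ.+ k))) →
    Play y z Y Z (λ n → tri e d ℚ.* seq D n ℚ.+ seq (ΣW e d b) n ℚ.* seq D n) (λ n → ι e ℚ.* seq D n)
  shift zero d b m m≡ D {y} {Y} {z} {Z} 0≤D lead arrive fixed spaced zlead zrest Zcov =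
    play-weaken (λ n → ℚ.≤-reflexive (vanish (seq D n))) (λ n → ℚ.≤-reflexive (sym (ℚ.*-zeroˡ (seq D n))))
      (play-stay {y} {z} {Y} {Z} y≋Y (λ k → zrest k ℕ.z≤n))
    where
    vanish : ∀ p → 0ℚ ℚ.* p ℚ.+ 0ℚ ℚ.* p ≡ 0ℚ
    vanish = solve-∀ ℚ-ring
    far≡ : ∀ p q → p ℚ.+ 0ℚ ℚ.* q ≡ p
    far≡ = solve-∀ ℚ-ring
    y≋Y : y ≋ Y
    y≋Y j n with j ℕ.≟ m
    ... | yes refl = sym (trans (arrive n) (far≡ (seq (pos (y j)) n) (seq D n)))
    ... | no j≢m   = fixed j (λ _ ()) j≢m n
  shift (suc e) d b m m≡ D {y} {Y} {z} {Z} 0≤D lead arrive fixed spaced zlead zrest Zcov =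
    play-weaken
      (λ n → ℚ.≤-reflexive (sum (ι (suc d)) (tri e (suc d)) (seq (W d i) n) (seq (ΣW e (suc d) b) n) (seq D n)))
      (λ n → ℚ.≤-reflexive (sum′ (ι e) (seq D n)))
      (play-trans
        (slide d i m m≡1+d+i D {y} {y₁} {z} {z₁} e 0≤D pull spaced₁
          (zlead e ℕ.≤-refl)
          (λ n → trans (put-at z e (Z e) n) (trans (Zcov e e<1+e+d n) (sym (y₁-i n))))
          (λ l l≢e n → sym (put-off z e (Z e) l≢e n))
          cov)
        (shift e (suc d) b m (trans m≡ (cong (b ℕ.+_) (sym (ℕ.+-suc e d)))) D {y₁} {Y} {z₁} {Z} 0≤D
          lead₁ far₁ rest₁ spaced
          (λ k k<e n → trans (put-off z e (Z e) (ℕ.<⇒≢ k<e) n)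
            (trans (zlead k (ℕ.m≤n⇒m≤1+n k<e) n) (sym (y₁-j (b ℕ.+ k) (below k k<e) (below-m k k<e) n))))
          zrest₁
          (λ k k< → Zcov k (subst (k ℕ.<_) (ℕ.+-suc e d) k<))))
    where
    i : ℕ
    i = b ℕ.+ e
    m≡1+d+i : m ≡ suc (d ℕ.+ i)
    m≡1+d+i = trans m≡ (trans (ℕ.+-suc b (e ℕ.+ d))
      (cong suc (trans (sym (ℕ.+-assoc b e d)) (ℕ.+-comm (b ℕ.+ e) d))))
    i<m : i ℕ.< m
    i<m = subst (i ℕ.<_) (sym m≡1+d+i) (ℕ.s≤s (ℕ.m≤n+m i d))
    e<1+e+d : e ℕ.< suc e ℕ.+ d
    e<1+e+d = ℕ.s≤s (ℕ.m≤m+n e d)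

    below : ∀ k → k ℕ.< e → b ℕ.+ k ≢ i
    below k k<e eq = ℕ.<-irrefl (ℕ.+-cancelˡ-≡ b k e eq) k<e
    below-m : ∀ k → k ℕ.< e → b ℕ.+ k ≢ m
    below-m k k<e eq = ℕ.<-irrefl eq (ℕ.<-trans (ℕ.+-monoʳ-< b k<e) i<m)

    r : Point
    r = shifted (pos (y m)) (W d i * D) (nonNeg (y m)) λ n → 0≤p*q (0≤W d i n) (0≤D n)

    x₁ y₁ z₁ : Config
    x₁ = put y i (Y i)
    y₁ = put x₁ m r
    z₁ = put z e (Z e)

    y₁-i : pos (y₁ i) ≐ pos (Y i)
    y₁-i n = trans (put-off x₁ m r (ℕ.<⇒≢ i<m) n) (put-at y i (Y i) n)

    y₁-m : pos (y₁ m) ≐ pos r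
    y₁-m = put-at x₁ m r

    y₁-j : ∀ j → j ≢ i → j ≢ m → pos (y₁ j) ≐ pos (y j)
    y₁-j j j≢i j≢m n = trans (put-off x₁ m r j≢m n) (put-off y i (Y i) j≢i n)

    pull : Pull d i m D y y₁
    pull .top n = trans (lead e ℕ.≤-refl n) (cong (ℚ._+ seq D n) (sym (y₁-i n)))
    pull .far = y₁-m
    pull .rest j j≢i j≢m n = sym (y₁-j j j≢i j≢m n)

    lead₁ : ∀ k → k ℕ.< e → pos (y₁ (b ℕ.+ k)) ≐ pos (Y (b ℕ.+ k)) + D
    lead₁ k k<e n = trans (y₁-j (b ℕ.+ k) (below k k<e) (below-m k k<e) n) (lead k (ℕ.m≤n⇒m≤1+n k<e) n)

    distrib : ∀ p w v a → p ℚ.+ (w ℚ.+ v) ℚ.* a ≡ p ℚ.+ w ℚ.* a ℚ.+ v ℚ.* a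
    distrib = solve-∀ ℚ-ring

    far₁ : pos (Y m) ≐ pos (y₁ m) + ΣW e (suc d) b * D
    far₁ n = trans (arrive n) (trans
      (distrib (seq (pos (y m)) n) (seq (W d i) n) (seq (ΣW e (suc d) b) n) (seq D n))
      (cong (ℚ._+ seq (ΣW e (suc d) b * D) n) (sym (y₁-m n))))

    rest₁ : ∀ j → (∀ k → k ℕ.< e → j ≢ b ℕ.+ k) → j ≢ m → pos (y₁ j) ≐ pos (Y j)
    rest₁ j j≢ j≢m n = by-cases (j ℕ.≟ i)
      where
      by-cases : Dec (j ≡ i) → seq (pos (y₁ j)) n ≡ seq (pos (Y j)) n
      by-cases (yes refl) = y₁-i n
      by-cases (no j≢i)   = trans (y₁-j j j≢i j≢m n) (fixed j avoid j≢m n)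
        where
        avoid : ∀ k → k ℕ.< suc e → j ≢ b ℕ.+ k
        avoid k k<1+e with ℕ.m≤n⇒m<n∨m≡n (ℕ.s≤s⁻¹ k<1+e)
        ... | inj₁ k<e  = j≢ k k<e
        ... | inj₂ refl = j≢i

    i≤⇒≢ : ∀ j → i ℕ.≤ j → ∀ k → k ℕ.< e → j ≢ b ℕ.+ k
    i≤⇒≢ j i≤j k k<e refl = ℕ.<-irrefl refl (ℕ.≤-<-trans i≤j (ℕ.+-monoʳ-< b k<e))

    y₁≤Y : ∀ j → i ℕ.≤ j → ∀ n → seq (pos (y₁ j)) n ℚ.≤ seq (pos (Y j)) n
    y₁≤Y j i≤j n = by-cases (j ℕ.≟ m)
      where
      by-cases : Dec (j ≡ m) → seq (pos (y₁ j)) n ℚ.≤ seq (pos (Y j)) n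
      by-cases (yes refl) = ℚ.≤-trans (p≤p+q (0≤p*q (0≤ΣW e (suc d) b n) (0≤D n))) (ℚ.≤-reflexive (sym (far₁ n)))
      by-cases (no j≢m)   = ℚ.≤-reflexive (rest₁ j (i≤⇒≢ j i≤j) j≢m n)

    spaced₁ : Spaced i m y₁
    spaced₁ j i≤j j<m n = ℚ.≤-trans
      (ℚ.+-monoˡ-≤ 1ℚ (y₁≤Y (suc j) (ℕ.m≤n⇒m≤1+n i≤j) n))
      (ℚ.≤-trans (spaced j (ℕ.≤-trans (ℕ.m≤m+n b e) i≤j) j<m n)
        (ℚ.≤-reflexive (sym (rest₁ j (i≤⇒≢ j i≤j) (ℕ.<⇒≢ j<m) n))))

    zrest₁ : ∀ k → e ℕ.≤ k → pos (z₁ k) ≐ pos (Z k)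
    zrest₁ k e≤k n = by-cases (ℕ.m≤n⇒m<n∨m≡n e≤k)
      where
      by-cases : e ℕ.< k ⊎ e ≡ k → seq (pos (z₁ k)) n ≡ seq (pos (Z k)) n
      by-cases (inj₂ refl) = put-at z e (Z e) n
      by-cases (inj₁ e<k)  = trans (put-off z e (Z e) (λ k≡e → ℕ.<-irrefl (sym k≡e) e<k) n) (zrest k e<k n)

    cov : ∀ j → i ℕ.< j → j ℕ.< m → ∃[ l ] (l ≢ e × pos (z₁ l) ≐ pos (y₁ j))
    cov j i<j j<m = l , (λ l≡e → ℕ.<-irrefl (trans (cong (b ℕ.+_) (sym l≡e)) b+l≡j) i<j) ,
      λ n → trans (zrest₁ l (ℕ.<⇒≤ e<l) n) (trans (Zcov l l< n)
        (trans (cong (λ k → seq (pos (Y k)) n) b+l≡j)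
          (sym (rest₁ j (i≤⇒≢ j (ℕ.<⇒≤ i<j)) (ℕ.<⇒≢ j<m) n))))
      where
      l : ℕ
      l = j ℕ.∸ b
      b+l≡j : b ℕ.+ l ≡ j
      b+l≡j = ℕ.m+[n∸m]≡n (ℕ.≤-trans (ℕ.m≤m+n b e) (ℕ.<⇒≤ i<j))
      e<l : e ℕ.< l
      e<l = ℕ.+-cancelˡ-< b e l (subst (i ℕ.<_) (sym b+l≡j) i<j)
      l< : l ℕ.< suc e ℕ.+ d
      l< = ℕ.+-cancelˡ-< b l (suc e ℕ.+ d) (subst₂ ℕ._<_ (sym b+l≡j) m≡ j<m)

    sum : ∀ k t w v a → (k ℚ.+ t) ℚ.* a ℚ.+ (w ℚ.+ v) ℚ.* a ≡
      k ℚ.* a ℚ.+ w ℚ.* a ℚ.+ (t ℚ.* a ℚ.+ v ℚ.* a)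
    sum = solve-∀ ℚ-ring
    sum′ : ∀ k a → a ℚ.+ k ℚ.* a ≡ (1ℚ ℚ.+ k) ℚ.* a
    sum′ = solve-∀ ℚ-ring

  -- Phases, planned backwards

  module Clusters (h′ : ℕ) where
    h : ℕ
    h = suc h′

    τ : ℚ
    τ = tri h 0

    -- The servers below `b`, discarded in earlier phases, are left unconstrained; those from
    -- `b + h` on are still at the source.
    record Cluster (b : ℕ) (Q : ℝ) (y z : Config) : Set where
      field
        servers : ∀ k → k ℕ.< h → pos (y (b ℕ.+ k)) ≐ Q + const (ι (h ℕ.∸ suc k))
        offline : ∀ k → k ℕ.< h → pos (z k) ≐ Q + const (ι (h ℕ.∸ suc k))
        home    : ∀ j → b ℕ.+ h ℕ.≤ j → pos (y j) ≐ 0ℝ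

    open Cluster

    ι-∸ : ∀ k → k ℕ.< h → ι (h ℕ.∸ k) ≡ 1ℚ ℚ.+ ι (h ℕ.∸ suc k)
    ι-∸ k k<h = cong ι (ℕ.+-∸-assoc 1 (ℕ.s≤s⁻¹ k<h))

    -- Multiplied by the total pull `ΣW h 0 b` it gives `Q`, so server `b + h` is drawn from the
    -- source exactly to `Q`.
    leftShift : ℕ → ℝ → ℝ
    leftShift b Q = Q * inv (ΣW h 0 b) (1≤ΣW h′ 0 b)

    -- `Q` is the position at which the next cluster is to stand. The summand 1 is there because
    -- server `b + h` arrives at `Q` itself, one unit left of the shifted cluster.
    advance : ℕ → ℝ → ℝ
    advance b Q = Q + leftShift b Q + 1ℝ

    0≤leftShift : ∀ b {Q} → (∀ n → 0ℚ ℚ.≤ seq Q n) → ∀ n → 0ℚ ℚ.≤ seq (leftShift b Q) n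
    0≤leftShift b 0≤Q n = 0≤p*q (0≤Q n) (0≤recip (1≤ΣW h′ 0 b n))

    phase : ∀ b Q → (∀ n → 0ℚ ℚ.≤ seq Q n) → ∀ {y z} → Cluster b (advance b Q) y z →
      ∃[ y′ ] ∃[ z′ ] (Cluster (suc b) Q y′ z′ ×
        Play y z y′ z′ (λ n → τ ℚ.* seq (leftShift b Q) n ℚ.+ seq Q n)
                       (λ n → ι h ℚ.* seq (leftShift b Q) n ℚ.+ ι h))
    phase b Q 0≤Q {y} {z} cluster = Y , Z′ , cluster′ , play-weaken
      (λ n → ℚ.≤-reflexive (trans
        (cong (τ ℚ.* seq D n ℚ.+_) (sym (pulled n)))
        (sym (ℚ.+-identityʳ (τ ℚ.* seq D n ℚ.+ seq (ΣW h 0 b) n ℚ.* seq D n)))))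
      (λ n → ℚ.+-monoʳ-≤ (ι h ℚ.* seq D n) (∑<-≤ι h {λ k → ∣ pos (Z′ k) - pos (Z k) ∣} {n}
        λ k k<h → ℚ.≤-reflexive (jump k k<h n)))
      (play-trans
        (shift h 0 b m (cong (b ℕ.+_) (sym (ℕ.+-identityʳ h))) D {y} {Y} {z} {Z} (0≤leftShift b {Q} 0≤Q)
          lead arrive fixed spaced
          (λ k k<h n → trans (offline cluster k k<h n) (sym (servers cluster k k<h n)))
          (λ k h≤k n → sym (Z-out k h≤k n))
          (λ k k<h+0 n → let k<h = subst (k ℕ.<_) (ℕ.+-identityʳ h) k<h+0 in
            trans (Z-in k k<h n) (sym (Y-in k (ℕ.<⇒≤ k<h) n))))
        -- A request at `Q`, where server `m` has arrived: each of the `h` offline servers moves one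
        -- unit to the left, so that they drop the rightmost point and cover `m`.
        (play-null {Y} {Z} {Z′} {distances h Z′ Z} (b ℕ.+ h′)
          (λ n → +1≤⇒≤ (spaced (b ℕ.+ h′) (ℕ.m≤m+n b h′) (ℕ.+-monoʳ-< b ℕ.≤-refl) n))
          (h′ , λ n → trans (Z′-in h′ ℕ.≤-refl n) (trans (sym (Y-in h ℕ.≤-refl n))
            (cong (λ j → seq (pos (Y j)) n) (ℕ.+-suc b h′))))
          (h , (λ k h≤k → ≐⇒≈ (pos (Z′ k)) (pos (Z k)) λ n → trans (Z′-out k h≤k n) (sym (Z-out k h≤k n))) ,
            ≐⇒≈ (distances h Z′ Z) (distances h Z′ Z) λ _ → refl)))
      where
      D : ℝ
      D = leftShift b Q
      m : ℕ
      m = b ℕ.+ h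

      in? : ∀ j → Dec (b ℕ.≤ j × j ℕ.≤ m)
      in? j = b ℕ.≤? j ×-dec j ℕ.≤? m

      Y Z Z′ : Config
      Y  = over in? (λ j → place Q 0≤Q (m ℕ.∸ j)) y
      Z  = over (ℕ._<? h) (λ k → place Q 0≤Q (h ℕ.∸ k)) z
      Z′ = over (ℕ._<? h) (λ k → place Q 0≤Q (h ℕ.∸ suc k)) z

      Y-in : ∀ k → k ℕ.≤ h → pos (Y (b ℕ.+ k)) ≐ Q + const (ι (h ℕ.∸ k))
      Y-in k k≤h n = trans
        (cong (λ a → seq (pos a) n) (over-yes in? (λ j → place Q 0≤Q (m ℕ.∸ j)) y
          (ℕ.m≤m+n b k , ℕ.+-monoʳ-≤ b k≤h)))
        (cong (λ j → seq Q n ℚ.+ ι j) (ℕ.[m+n]∸[m+o]≡n∸o b h k))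

      Y-out : ∀ j → ¬ (b ℕ.≤ j × j ℕ.≤ m) → pos (Y j) ≐ pos (y j)
      Y-out j out n = cong (λ a → seq (pos a) n) (over-no in? (λ j → place Q 0≤Q (m ℕ.∸ j)) y out)

      Z-in : ∀ k → k ℕ.< h → pos (Z k) ≐ Q + const (ι (h ℕ.∸ k))
      Z-in k k<h n = cong (λ a → seq (pos a) n) (over-yes (ℕ._<? h) (λ k → place Q 0≤Q (h ℕ.∸ k)) z k<h)

      Z′-in : ∀ k → k ℕ.< h → pos (Z′ k) ≐ Q + const (ι (h ℕ.∸ suc k))
      Z′-in k k<h n = cong (λ a → seq (pos a) n) (over-yes (ℕ._<? h) (λ k → place Q 0≤Q (h ℕ.∸ suc k)) z k<h)

      Z-out : ∀ k → h ℕ.≤ k → pos (Z k) ≐ pos (z k)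
      Z-out k h≤k n = cong (λ a → seq (pos a) n)
        (over-no (ℕ._<? h) (λ k → place Q 0≤Q (h ℕ.∸ k)) z (ℕ.≤⇒≯ h≤k))

      Z′-out : ∀ k → h ℕ.≤ k → pos (Z′ k) ≐ pos (z k)
      Z′-out k h≤k n = cong (λ a → seq (pos a) n)
        (over-no (ℕ._<? h) (λ k → place Q 0≤Q (h ℕ.∸ suc k)) z (ℕ.≤⇒≯ h≤k))

      Y-suc : ∀ k → k ℕ.< h → pos (Y (suc (b ℕ.+ k))) ≐ Q + const (ι (h ℕ.∸ suc k))
      Y-suc k k<h n = trans (cong (λ j → seq (pos (Y j)) n) (sym (ℕ.+-suc b k))) (Y-in (suc k) k<h n)

      lead : ∀ k → k ℕ.< h → pos (y (b ℕ.+ k)) ≐ pos (Y (b ℕ.+ k)) + D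
      lead k k<h n = trans (servers cluster k k<h n)
        (trans (regroup (seq Q n) (seq D n) (ι (h ℕ.∸ suc k)))
          (cong (ℚ._+ seq D n) (sym (trans (Y-in k (ℕ.<⇒≤ k<h) n) (cong (seq Q n ℚ.+_) (ι-∸ k k<h))))))
        where
        regroup : ∀ q d k → q ℚ.+ d ℚ.+ 1ℚ ℚ.+ k ≡ q ℚ.+ (1ℚ ℚ.+ k) ℚ.+ d
        regroup = solve-∀ ℚ-ring

      pulled : ∀ n → seq (ΣW h 0 b) n ℚ.* seq D n ≡ seq Q n
      pulled n = trans (regroup (seq (ΣW h 0 b) n) (seq Q n) (recip (1≤ΣW h′ 0 b n)))
        (trans (cong (seq Q n ℚ.*_) (*-recip (1≤ΣW h′ 0 b n))) (ℚ.*-identityʳ (seq Q n)))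
        where
        regroup : ∀ w q r → w ℚ.* (q ℚ.* r) ≡ q ℚ.* (w ℚ.* r)
        regroup = solve-∀ ℚ-ring

      arrive : pos (Y m) ≐ pos (y m) + ΣW h 0 b * D
      arrive n = trans (Y-in h ℕ.≤-refl n) (trans
        (cong (λ j → seq Q n ℚ.+ ι j) (ℕ.n∸n≡0 h))
        (trans (ℚ.+-comm (seq Q n) 0ℚ)
          (cong₂ ℚ._+_ (sym (home cluster m ℕ.≤-refl n)) (sym (pulled n)))))

      fixed : ∀ j → (∀ k → k ℕ.< h → j ≢ b ℕ.+ k) → j ≢ m → pos (y j) ≐ pos (Y j)
      fixed j j≢ j≢m n = sym (Y-out j out n)
        where
        out : ¬ (b ℕ.≤ j × j ℕ.≤ m)
        out (b≤j , j≤m) = j≢ (j ℕ.∸ b)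
          (ℕ.+-cancelˡ-< b (j ℕ.∸ b) h (subst (ℕ._< m) (sym (ℕ.m+[n∸m]≡n b≤j)) (ℕ.≤∧≢⇒< j≤m j≢m)))
          (sym (ℕ.m+[n∸m]≡n b≤j))

      spaced : Spaced b m Y
      spaced j b≤j j<m n = subst (λ j → seq (pos (Y (suc j))) n ℚ.+ 1ℚ ℚ.≤ seq (pos (Y j)) n)
        (ℕ.m+[n∸m]≡n b≤j) (ℚ.≤-reflexive (trans (cong (ℚ._+ 1ℚ) (Y-suc k k<h n))
          (trans (regroup (seq Q n) (ι (h ℕ.∸ suc k)))
            (sym (trans (Y-in k (ℕ.<⇒≤ k<h) n) (cong (seq Q n ℚ.+_) (ι-∸ k k<h)))))))
        where
        k : ℕ
        k = j ℕ.∸ b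
        k<h : k ℕ.< h
        k<h = ℕ.+-cancelˡ-< b k h (subst (ℕ._< m) (sym (ℕ.m+[n∸m]≡n b≤j)) j<m)
        regroup : ∀ p q → p ℚ.+ q ℚ.+ 1ℚ ≡ p ℚ.+ (1ℚ ℚ.+ q)
        regroup = solve-∀ ℚ-ring

      jump : ∀ k → k ℕ.< h → ∀ n → seq ∣ pos (Z′ k) - pos (Z k) ∣ n ≡ 1ℚ
      jump k k<h n = cong ℚ.∣_∣ (trans
        (cong₂ ℚ._-_ (Z′-in k k<h n) (trans (Z-in k k<h n) (cong (seq Q n ℚ.+_) (ι-∸ k k<h))))
        (difference (seq Q n) (ι (h ℕ.∸ suc k))))
        where
        difference : ∀ p q → p ℚ.+ q ℚ.- (p ℚ.+ (1ℚ ℚ.+ q)) ≡ ℚ.- 1ℚ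
        difference = solve-∀ ℚ-ring

      cluster′ : Cluster (suc b) Q Y Z′
      cluster′ .servers = Y-suc
      cluster′ .offline = Z′-in
      cluster′ .home j m<j n = trans (Y-out j (λ (_ , j≤m) → ℕ.<-irrefl refl (ℕ.<-≤-trans m<j j≤m)) n)
        (home cluster j (ℕ.<⇒≤ m<j) n)

    -- The position of cluster `b` when `t` phases are still to come. Ending at τ ensures that in
    -- every phase the incoming server travels at least τ.
    level : ℕ → ℕ → ℝ
    level zero    b = const τ
    level (suc t) b = advance b (level t (suc b))

    τ≤level : ∀ t b n → τ ℚ.+ ι t ℚ.≤ seq (level t b) n
    τ≤level zero    b n = ℚ.≤-reflexive (ℚ.+-identityʳ τ)
    τ≤level (suc t) b n = ≤-by (Q ℚ.- (τ ℚ.+ ι t) ℚ.+ D) (0≤p+q (0≤q-p ih) (0≤leftShift b {level t (suc b)} 0≤Q n))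
        (regroup τ (ι t) Q D)
      where
      Q D : ℚ
      Q = seq (level t (suc b)) n
      D = seq (leftShift b (level t (suc b))) n
      ih : τ ℚ.+ ι t ℚ.≤ Q
      ih = τ≤level t (suc b) n
      0≤Q : ∀ n → 0ℚ ℚ.≤ seq (level t (suc b)) n
      0≤Q n = ℚ.≤-trans (0≤p+q (0≤tri h 0) (0≤ι t)) (τ≤level t (suc b) n)
      regroup : ∀ τ t q d → q ℚ.+ d ℚ.+ 1ℚ ≡ τ ℚ.+ (1ℚ ℚ.+ t) ℚ.+ (q ℚ.- (τ ℚ.+ t) ℚ.+ d)
      regroup = solve-∀ ℚ-ring

    0≤level : ∀ t b n → 0ℚ ℚ.≤ seq (level t b) n
    0≤level t b n = ℚ.≤-trans (0≤p+q (0≤tri h 0) (0≤ι t)) (τ≤level t b n)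

    -- A phase lowers the level by D + 1, so both bounds telescope; the travel `Q ≥ τ` of the
    -- incoming server pays for the summand 1.
    phases : ∀ t b {y z} → Cluster b (level t b) y z →
      ∃[ y′ ] ∃[ z′ ] Play y z y′ z′ (λ n → τ ℚ.* (seq (level t b) n ℚ.- τ))
                                     (λ n → ι h ℚ.* (seq (level t b) n ℚ.- τ))
    phases zero b {y} {z} cluster = y , z , play-weaken
      (λ n → ℚ.≤-reflexive (vanish τ τ)) (λ n → ℚ.≤-reflexive (sym (vanish (ι h) τ)))
      (play-stay {y} {z} (λ _ _ → refl) (λ _ _ → refl))
      where
      vanish : ∀ p q → p ℚ.* (q ℚ.- q) ≡ 0ℚ
      vanish = solve-∀ ℚ-ring
    phases (suc t) b {y} {z} cluster =
      let y₁ , z₁ , cluster₁ , play₁ = phase b Q (0≤level t (suc b)) {y} {z} cluster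
          y₂ , z₂ , play₂ = phases t (suc b) {y₁} {z₁} cluster₁
      in y₂ , z₂ , play-weaken
        (λ n → ≤-by (seq Q n ℚ.- τ) (0≤q-p (ℚ.≤-trans (p≤p+q (0≤ι t)) (τ≤level t (suc b) n)))
          (balance τ (seq Q n) (seq D n)))
        (λ n → ℚ.≤-reflexive (balance′ (ι h) τ (seq Q n) (seq D n)))
        (play-trans play₁ play₂)
      where
      Q D : ℝ
      Q = level t (suc b)
      D = leftShift b Q
      balance : ∀ τ q d → τ ℚ.* d ℚ.+ q ℚ.+ τ ℚ.* (q ℚ.- τ) ≡ τ ℚ.* (q ℚ.+ d ℚ.+ 1ℚ ℚ.- τ) ℚ.+ (q ℚ.- τ)
      balance = solve-∀ ℚ-ring
      balance′ : ∀ h τ q d → h ℚ.* d ℚ.+ h ℚ.+ h ℚ.* (q ℚ.- τ) ≡ h ℚ.* (q ℚ.+ d ℚ.+ 1ℚ ℚ.- τ)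
      balance′ = solve-∀ ℚ-ring

    -- Deploying the first cluster

    module Start (Q : ℝ) (0≤Q : ∀ n → 0ℚ ℚ.≤ seq Q n) where

      p : ℕ → Point
      p k = place Q 0≤Q (h ℕ.∸ suc k)

      record Partial (m : ℕ) (y z : Config) : Set where
        field
          out     : ∀ k → k ℕ.< m → pos (y k) ≐ pos (p k)
          outᶻ    : ∀ k → k ℕ.< m → pos (z k) ≐ pos (p k)
          inside  : ∀ j → m ℕ.≤ j → pos (y j) ≐ 0ℝ
          insideᶻ : ∀ j → m ℕ.≤ j → pos (z j) ≐ 0ℝ

      open Partial

      P : ℕ → ℚ
      P n = seq Q n ℚ.+ ι h

      0≤P : ∀ n → 0ℚ ℚ.≤ P n
      0≤P n = 0≤p+q (0≤Q n) (0≤ι h)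

      0≤p : ∀ k n → 0ℚ ℚ.≤ seq (pos (p k)) n
      0≤p k n = 0≤p+q (0≤Q n) (0≤ι (h ℕ.∸ suc k))

      p≤P : ∀ k n → seq (pos (p k)) n ℚ.≤ P n
      p≤P k n = ℚ.+-monoʳ-≤ (seq Q n) (ι-mono (ℕ.m∸n≤m h (suc k)))

      ∣p-0∣≤P : ∀ k {x} n → seq x n ≡ 0ℚ → seq ∣ pos (p k) - x ∣ n ℚ.≤ P n
      ∣p-0∣≤P k {x} n x≡0 = ℚ.≤-trans (ℚ.≤-reflexive (trans
        (cong (λ q → ℚ.∣ seq (pos (p k)) n ℚ.- q ∣) x≡0)
        (trans (cong ℚ.∣_∣ (ℚ.+-identityʳ (seq (pos (p k)) n))) (ℚ.0≤p⇒∣p∣≡p (0≤p k n))))) (p≤P k n)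

      partial-suc : ∀ {m y z} → Partial m y z → Partial (suc m) (put y m (p m)) (put z m (p m))
      partial-suc {m} {y} {z} st = λ where
          .out k k<1+m n     → placed y (out st) k (ℕ.m≤n⇒m<n∨m≡n (ℕ.s≤s⁻¹ k<1+m)) n
          .outᶻ k k<1+m n    → placed z (outᶻ st) k (ℕ.m≤n⇒m<n∨m≡n (ℕ.s≤s⁻¹ k<1+m)) n
          .inside j m<j n    → trans (put-off y m (p m) (ℕ.<⇒≢ m<j ∘ sym) n) (inside st j (ℕ.<⇒≤ m<j) n)
          .insideᶻ j m<j n   → trans (put-off z m (p m) (ℕ.<⇒≢ m<j ∘ sym) n) (insideᶻ st j (ℕ.<⇒≤ m<j) n)
        where
        placed : ∀ y → (∀ k → k ℕ.< m → pos (y k) ≐ pos (p k)) →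
          ∀ k → k ℕ.< m ⊎ k ≡ m → pos (put y m (p m) k) ≐ pos (p k)
        placed y out k (inj₁ k<m)  n = trans (put-off y m (p m) (ℕ.<⇒≢ k<m) n) (out k k<m n)
        placed y out k (inj₂ refl) n = put-at y m (p m) n

      -- To fetch server `suc m` from the source, the rightmost server is lured to the right by D
      -- and called back by a slide; D is the target position divided by the pull, so the fetched
      -- server stops exactly there. Offline, server 0 goes and returns and one server comes out:
      -- three moves of length at most `P`.
      deploy : ∀ m → suc m ℕ.< h → ∀ {y z} → Partial (suc m) y z →
        Play y z (put y (suc m) (p (suc m))) (put z (suc m) (p (suc m))) (λ _ → 0ℚ) (λ n → P n ℚ.+ (P n ℚ.+ P n))
      deploy m′ m<h {y} {z} st = play-weaken
        (λ n → 0≤p+q {0ℚ} ℚ.≤-refl (0≤p+q (0≤p+q (0≤p*q (0≤ι m) (0≤D n)) (0≤p*q (0≤W m′ 0 n) (0≤D n))) ℚ.≤-refl))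
        (λ n → ℚ.+-mono-≤ (ℚ.≤-trans (ℚ.≤-reflexive (jump n)) (D≤P n))
          (ℚ.+-mono-≤ (D≤P n) (∣p-0∣≤P m {pos (z m)} n (insideᶻ st m ℕ.≤-refl n))))
        (play-trans
          (play-outer {y} {z} r 0 (λ n → ℚ.≤-trans (ℚ.≤-reflexive (out st 0 0<m n)) (p≤p+q (0≤D n))))
          (play-trans
            (slide m′ 0 m (cong suc (sym (ℕ.+-identityʳ m′))) D {y₁} {Y} {z₁} {z} 0 0≤D pull spaced
              (λ n → trans (put-at z 0 r n) (sym (put-at y 0 r n)))
              (λ n → trans (outᶻ st 0 0<m n) (sym (Y-p 0 0<1+m n)))
              (λ l l≢0 n → put-off z 0 r l≢0 n)
              (λ j 0<j j<m → j , (ℕ.<⇒≢ 0<j ∘ sym) ,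
                λ n → trans (outᶻ st j j<m n) (sym (Y-p j (ℕ.m≤n⇒m≤1+n j<m) n))))
            (play-null {Y} {z} {put z m (p m)} {∣ pos (p m) - pos (z m) ∣} m′
              (λ n → +1≤⇒≤ (spaced m′ ℕ.z≤n ℕ.≤-refl n))
              (m , λ n → trans (put-at z m (p m) n) (sym (Y-p m ℕ.≤-refl n)))
              (put-travel z m (p m)))))
        where
        m : ℕ
        m = suc m′
        0<m : 0 ℕ.< m
        0<m = ℕ.s≤s ℕ.z≤n
        0<1+m : 0 ℕ.< suc m
        0<1+m = ℕ.s≤s ℕ.z≤n

        W⁻¹ D : ℝ
        W⁻¹ = inv (W m′ 0) (1≤W m′ 0)
        D = pos (p m) * W⁻¹

        0≤D : ∀ n → 0ℚ ℚ.≤ seq D n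
        0≤D n = 0≤p*q (0≤p m n) (0≤recip (1≤W m′ 0 n))

        D≤P : ∀ n → seq D n ℚ.≤ P n
        D≤P n = ℚ.≤-trans (*-monoˡ (seq (pos (p m)) n) (0≤p m n) (recip≤1 (1≤W m′ 0 n)))
          (ℚ.≤-trans (ℚ.≤-reflexive (ℚ.*-identityʳ (seq (pos (p m)) n))) (p≤P m n))

        r : Point
        r = shifted (pos (p 0)) D (nonNeg (p 0)) 0≤D

        y₁ z₁ Y : Config
        y₁ = put y 0 r
        z₁ = put z 0 r
        Y = put y m (p m)

        Y-p : ∀ j → j ℕ.< suc m → pos (Y j) ≐ pos (p j)
        Y-p = out (partial-suc st)

        pulled : ∀ n → seq (W m′ 0) n ℚ.* seq D n ≡ seq (pos (p m)) n
        pulled n = trans (regroup (seq (W m′ 0) n) (seq (pos (p m)) n) (seq W⁻¹ n))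
          (trans (cong (seq (pos (p m)) n ℚ.*_) (*-recip (1≤W m′ 0 n))) (ℚ.*-identityʳ (seq (pos (p m)) n)))
          where
          regroup : ∀ w q r → w ℚ.* (q ℚ.* r) ≡ q ℚ.* (w ℚ.* r)
          regroup = solve-∀ ℚ-ring

        pull : Pull m′ 0 m D y₁ Y
        pull .top n = trans (put-at y 0 r n) (cong (ℚ._+ seq D n) (sym (Y-p 0 0<1+m n)))
        pull .far n = trans (put-at y m (p m) n) (trans (sym (pulled n))
          (trans (sym (ℚ.+-identityˡ (seq (W m′ 0) n ℚ.* seq D n)))
            (cong (ℚ._+ seq (W m′ 0) n ℚ.* seq D n)
              (sym (trans (put-off y 0 r (λ ()) n) (inside st m ℕ.≤-refl n))))))
        pull .rest j j≢0 j≢m n = trans (put-off y 0 r j≢0 n) (sym (put-off y m (p m) j≢m n))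

        spaced : Spaced 0 m Y
        spaced j _ j<m n = ℚ.≤-reflexive (trans (cong (ℚ._+ 1ℚ) (Y-p (suc j) (ℕ.s≤s j<m) n))
          (trans (regroup (seq Q n) (ι (h ℕ.∸ suc (suc j))))
            (trans (cong (seq Q n ℚ.+_) (sym (ι-∸ (suc j) (ℕ.<-≤-trans (ℕ.s≤s j<m) m<h))))
              (sym (Y-p j (ℕ.m≤n⇒m≤1+n j<m) n)))))
          where
          regroup : ∀ p q → p ℚ.+ q ℚ.+ 1ℚ ≡ p ℚ.+ (1ℚ ℚ.+ q)
          regroup = solve-∀ ℚ-ring

        jump : ∀ n → seq ∣ pos r - pos (z 0) ∣ n ≡ seq D n
        jump n = trans (cong (λ q → ℚ.∣ seq (pos r) n ℚ.- q ∣) (outᶻ st 0 0<m n))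
          (trans (cong ℚ.∣_∣ (Estimates.add-sub′ (seq (pos (p 0)) n) (seq D n))) (ℚ.0≤p⇒∣p∣≡p (0≤D n)))

      deployed : ∀ m → m ℕ.< h → ∃[ y ] ∃[ z ] (Partial (suc m) y z ×
        Play source source y z (λ _ → 0ℚ) (λ n → ι (suc m) ℚ.* (P n ℚ.+ (P n ℚ.+ P n))))
      deployed zero _ = put source 0 (p 0) , put source 0 (p 0) ,
        partial-suc (λ where
          .out _ ()
          .outᶻ _ ()
          .inside _ _ _ → refl
          .insideᶻ _ _ _ → refl) ,
        play-weaken (λ _ → ℚ.≤-refl)
          (λ n → ℚ.≤-trans (∣p-0∣≤P 0 {0ℝ} n refl) (≤-by (P n ℚ.+ P n) (0≤p+q (0≤P n) (0≤P n)) (triple (P n))))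
          (play-outer {source} {source} (p 0) 0 (0≤p 0))
        where
        triple : ∀ p → (1ℚ ℚ.+ 0ℚ) ℚ.* (p ℚ.+ (p ℚ.+ p)) ≡ p ℚ.+ (p ℚ.+ p)
        triple = solve-∀ ℚ-ring
      deployed (suc m) 1+m<h with deployed m (ℕ.<⇒≤ 1+m<h)
      ... | y , z , st , play = put y (suc m) (p (suc m)) , put z (suc m) (p (suc m)) , partial-suc st ,
        play-weaken (λ _ → ℚ.≤-reflexive (ℚ.+-identityˡ 0ℚ))
          (λ n → ℚ.≤-reflexive (collect (ι (suc m)) (P n ℚ.+ (P n ℚ.+ P n))))
          (play-trans play (deploy m 1+m<h st))
        where
        collect : ∀ k q → k ℚ.* q ℚ.+ q ≡ (1ℚ ℚ.+ k) ℚ.* q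
        collect = solve-∀ ℚ-ring

      start : ∃[ y ] ∃[ z ] (Cluster 0 Q y z ×
        Play source source y z (λ _ → 0ℚ) (λ n → ι h ℚ.* (P n ℚ.+ (P n ℚ.+ P n))))
      start with deployed h′ ℕ.≤-refl
      ... | y , z , st , play = y , z , cluster , play
        where
        cluster : Cluster 0 Q y z
        cluster .servers = out st
        cluster .offline = outᶻ st
        cluster .home    = inside st

  -- Contradiction with competitiveness

  module _ (ρ c : ℝ) (competitive : ∀ σ a v → DC s σ a → OPT σ v → a ≤ ρ * v + c)
           {R C : ℕ} (ρ≤R : ∀ n → ℚ.∣ seq ρ n ∣ ℚ.≤ ι R) (c≤C : ∀ n → ℚ.∣ seq c n ∣ ℚ.≤ ι C) where

    -- The two summands 1 are tolerances, one for OPT against the offline cost and one for the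
    -- competitive inequality. Both hold from some index on, and one common index is enough.
    play-ratio : ∀ {y z A B} → Play source source y z A B →
      ∃[ n ] A n ℚ.≤ ι R ℚ.* (B n ℚ.+ 1ℚ) ℚ.+ ι C ℚ.+ 1ℚ
    play-ratio {y} {z} {A} {B} (played {σ} {a} {b} algPath offlinePath A≤a b≤B) =
      compare (competitive σ a v (path⇒run algPath) (opt-OPT σ) 1ℚ)
              (proj₁ (opt-OPT σ) b (path⇒run offlinePath) 1ℚ)
      where
      v : ℝ
      v = opt 0 source σ
      compare : ∃[ N ] (∀ n → N ℕ.≤ n → seq a n ℚ.≤ seq ρ n ℚ.* seq v n ℚ.+ seq c n ℚ.+ 1ℚ) →
        ∃[ N ] (∀ n → N ℕ.≤ n → seq v n ℚ.≤ seq b n ℚ.+ 1ℚ) →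
        ∃[ n ] A n ℚ.≤ ι R ℚ.* (B n ℚ.+ 1ℚ) ℚ.+ ι C ℚ.+ 1ℚ
      compare (M , a≤) (N , v≤) = n , ℚ.≤-trans (A≤a n) (ℚ.≤-trans (a≤ n (ℕ.m≤m⊔n M N))
        (ℚ.+-monoˡ-≤ 1ℚ (ℚ.+-mono-≤
          (ℚ.≤-trans (*-monoʳ (seq v n) (opt-nonneg 0 source σ n) (ℚ.≤-trans (p≤∣p∣ (seq ρ n)) (ρ≤R n)))
            (*-monoˡ (ι R) (0≤ι R) (ℚ.≤-trans (v≤ n (ℕ.m≤n⊔m M N)) (ℚ.+-monoˡ-≤ 1ℚ (b≤B n)))))
          (ℚ.≤-trans (p≤∣p∣ (seq c n)) (c≤C n)))))
        where
        n : ℕ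
        n = M ℕ.⊔ N

  module _ (h′ : ℕ) where
    open Clusters h′

    -- At least τ phases, each lowering the level by at least 1, put the first cluster at 2τ or
    -- beyond, as `overflow` requires.
    horizon : ℕ
    horizon = proj₁ (archimedean τ)

    Q : ℝ
    Q = level horizon 0

    open Start Q (0≤level horizon 0) using (start; P)

    attack : ∃[ y ] ∃[ z ] Play source source y z
      (λ n → τ ℚ.* (seq Q n ℚ.- τ))
      (λ n → ι h ℚ.* (P n ℚ.+ (P n ℚ.+ P n)) ℚ.+ ι h ℚ.* (seq Q n ℚ.- τ))
    attack =
      let y₁ , z₁ , cluster , play₁ = start
          y₂ , z₂ , play₂ = phases horizon 0 {y₁} {z₁} cluster
      in y₂ , z₂ , play-weaken (λ n → ℚ.≤-reflexive (sym (ℚ.+-identityˡ (τ ℚ.* (seq Q n ℚ.- τ)))))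
           (λ _ → ℚ.≤-refl) (play-trans play₁ play₂)

    2τ≤Q : ∀ n → τ ℚ.+ τ ℚ.≤ seq Q n
    2τ≤Q n = ℚ.≤-trans (ℚ.+-monoʳ-≤ τ (proj₂ (archimedean τ))) (τ≤level horizon 0 n)

  not-competitive : ¬ Competitive (DC s)
  not-competitive (ρ , c , competitive) = refute (bounded ρ) (bounded c)
    where
    refute : ∃[ R ] (∀ n → ℚ.∣ seq ρ n ∣ ℚ.≤ ι R) → ∃[ C ] (∀ n → ℚ.∣ seq c n ∣ ℚ.≤ ι C) → ⊥
    refute (R , ρ≤R) (C , c≤C) =
      let _ , _ , play = attack h′
          n , A≤ = play-ratio ρ c competitive {R} {C} ρ≤R c≤C play
      in overflow (0≤tri (suc h′) 0) (0≤ι R) (0≤ι C) size (tri+tri (suc h′) 0) (2τ≤Q h′ n) A≤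
      where
      h′ : ℕ
      -- One less than 5 + 32R + 4C, the cluster size for which `overflow` applies.
      h′ = 4 ℕ.+ (32 ℕ.* R ℕ.+ 4 ℕ.* C)
      size : ι (suc h′) ≡ ι 5 ℚ.+ (ι 32 ℚ.* ι R ℚ.+ ι 4 ℚ.* ι C)
      size = trans (ι-+ 5 (32 ℕ.* R ℕ.+ 4 ℕ.* C)) (cong (ι 5 ℚ.+_)
        (trans (ι-+ (32 ℕ.* R) (4 ℕ.* C)) (cong₂ ℚ._+_ (ι-* 32 R) (ι-* 4 C))))

theorem9 : (s : ℕ → ℝ) → (∀ i → 1ℝ ≤ s i) → Monotonic₁ ℕ._≤_ _≤_ s ⊎ Antitonic₁ ℕ._≤_ _≤_ s → ¬ Competitive (DC s)
theorem9 s 1≤s _ = Adversary.not-competitive s 1≤s
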